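{- There is an absolute constant $C$, and for all $r_0,\delta,\Lambda,d$ a constant $C_{r_0,\delta,\Lambda,d}$, such that the following holds. Let $G$ be a $d$-regular graph on $n$ vertices, let $\mathcal C$ be a consistent family of even cycles of $G$ of length at most $L$, let $W=\operatorname{span}_{\mathbb F_2}\{\chi_C:C\in\mathcal C\}$, and put $\Lambda_W:=\max_{z\in W}|z|$. Assume $\Lambda_W\le\ell$ and that $G$ is $(r_0,\delta)$-subcritical at scale $\ell$. Then $$\sum_{z\in W}N^{\mathrm{nb}}_\ell(z)\le C_{r_0,\delta,\Lambda_W,d}\;n\,(C\ell)^{3(r_0+1)^2}\bigl((1+\delta)^{2(r_0+2)}\sqrt{d-1}\bigr)^{\ell},$$ where $N^{\mathrm{nb}}_\ell(z)$ is the number of closed non-backtracking walks of length $\ell$ and parity $z$ in $G$.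
   Context: $G=(V,E)$ is a finite simple connected graph. For a cycle $C$, $\chi_C\in\mathbb F_2^E$ is the indicator vector of its edge set; even cycles are cycles of even length. A family $\mathcal C$ of even cycles is consistent if the system $s\cdot\chi_C=1$ $(C\in\mathcal C)$ in the unknown $s\in\mathbb F_2^E$ has a solution over $\mathbb F_2$. For $z\in\mathbb F_2^E$, $|z|$ is the number of nonzero coordinates. A closed non-backtracking walk of length $t$ is a sequence of directed edges $(e_1,\dots,e_t)$ with head of $e_i$ equal to tail of $e_{i+1}$ and $e_{i+1}\ne\bar e_i$ for all $i$ modulo $t$ ($\bar e$ the reversal of $e$; the starting directed edge is marked). Its parity is the vector in $\mathbb F_2^E$ whose $e$-coordinate is the number of traversals of $e$ modulo $2$. For a non-negative integer $r_0$ and real $\delta\ge0$, $G$ is $(r_0,\delta)$-subcritical at scale $\ell$ if every connected subgraph $H$ of $G$ with minimum degree at least $2$ and at most $\ell$ edges satisfies: (i) the cycle rank $|E(H)|-|V(H)|+1$ of $H$ is at most $r_0$; and (ii) the number $c_H(t)$ of closed non-backtracking walks of length $t$ in $H$ satisfies $c_H(t)\le2|E(H)|\,(t+1)^{3r_0}(1+\delta)^t$ for all $t\le8\ell$. -}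

module Defs where

open import Algebra.Bundles using (module CommutativeMonoid)
open import Data.Bool.Base using (Bool; true; false; not; if_then_else_)
import Data.Bool.Properties as Bool
open import Data.Fin.Base as Fin using (Fin)
import Data.Fin.Properties as Fin
open import Data.Fin.Subset as Subset using (Subset; ⊤; Nonempty)
import Data.Fin.Subset.Properties as Subset
open import Data.Integer.Base as ℤ using (ℤ; +_)
import Data.Integer.Properties as ℤ
open import Data.List.Base as List using (List; []; _∷_; length; filter; map; cartesianProductWith; deduplicate; allFin)
open import Data.List.Extrema.Nat using (max)
open import Data.List.Relation.Unary.All as ListAll using ()
open import Data.Nat.Base using (ℕ; zero; suc; _+_; _*_; _∸_; _^_; _≤_; _<_; _⊔_; z≤n; s≤s; parity)
import Data.Nat.Properties as ℕ
open import Data.Nat.Divisibility using (_∣_)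
open import Data.Nat.Solver using (module +-*-Solver)
open import Data.Parity.Base as ℙ using (Parity; 0ℙ; 1ℙ)
import Data.Parity.Properties as ℙ
open import Data.Product using (∃; _×_; _,_; proj₁; proj₂)
open import Data.Product.Properties using (≡-dec)
open import Data.Rational.Base as ℚ using (ℚ; 0ℚ; 1ℚ; ½; ∣_∣; mkℚ)
import Data.Rational.Properties as ℚ
import Data.Rational.Unnormalised.Base as ℚᵘ
import Data.Rational.Unnormalised.Properties as ℚᵘ
open import Data.Sum.Base using (_⊎_; inj₁; inj₂)
open import Data.Vec.Base as Vec using (Vec; []; _∷_; tabulate; zipWith; replicate; count; fromList)
import Data.Vec.Properties as Vec
open import Data.Vec.Relation.Unary.All as VecAll using ()
open import Data.Vec.Relation.Unary.Any as VecAny using ()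
open import Data.Vec.Relation.Unary.Unique.Propositional using (Unique)
open import Relation.Binary.Construct.Closure.ReflexiveTransitive using (Star)
open import Relation.Binary.Definitions using (DecidableEquality)
open import Relation.Binary.PropositionalEquality
open import Relation.Nullary using (¬_; Dec; yes; no; does; ¬?; _×-dec_; _⊎-dec_)
open import Relation.Nullary.Decidable using (map′)

open import Algebra.Properties.AbelianGroup ℚ.+-0-abelianGroup using (xyx⁻¹≈y; ⁻¹-involutive)
open import Algebra.Properties.CommutativeSemigroup (CommutativeMonoid.commutativeSemigroup ℚ.+-0-commutativeMonoid) using (interchange)

infixl 6 _+ᴿ_
infixl 7 _*ᴿ_
infixr 8 _^ᴿ_
infix  4 _≤ᴿ_

Cauchy : (ℕ → ℚ) → Set
Cauchy x = ∀ {ε} → 0ℚ ℚ.< ε →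
  ∃ λ N → ∀ {i j} → N ≤ i → N ≤ j → ∣ x i ℚ.- x j ∣ ℚ.< ε

-- The real numbers as Cauchy sequences of rationals; the modulus is the
-- Σ-witness in `Cauchy`.
record ℝ : Set where
  field
    seq    : ℕ → ℚ
    cauchy : Cauchy seq

open ℝ public

_≤ᴿ_ : ℝ → ℝ → Set
x ≤ᴿ y = ∀ {ε} → 0ℚ ℚ.< ε → ∃ λ N → ∀ {i} → N ≤ i → seq x i ℚ.≤ seq y i ℚ.+ ε

constᴿ : ℚ → ℝ
constᴿ q = record
  { seq    = λ _ → q
  ; cauchy = λ 0<ε → 0 , λ _ _ → subst (ℚ._< _) (cong ∣_∣ (sym (ℚ.+-inverseʳ q))) 0<ε
  }

fromℕᴿ : ℕ → ℝ
fromℕᴿ n = constᴿ (+ n ℚ./ 1)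

0<½* : ∀ {ε} → 0ℚ ℚ.< ε → 0ℚ ℚ.< ½ ℚ.* ε
0<½* {ε} 0<ε = subst (ℚ._< ½ ℚ.* ε) (ℚ.*-zeroʳ ½) (ℚ.*-monoʳ-<-pos ½ 0<ε)

½+½ : ∀ ε → ½ ℚ.* ε ℚ.+ ½ ℚ.* ε ≡ ε
½+½ ε = trans (sym (ℚ.*-distribʳ-+ ε ½ ½)) (ℚ.*-identityˡ ε)

[p-q]+q≡p : ∀ p q → p ℚ.- q ℚ.+ q ≡ p
[p-q]+q≡p p q = trans (ℚ.+-assoc p (ℚ.- q) q)
               (trans (cong (p ℚ.+_) (ℚ.+-inverseˡ q)) (ℚ.+-identityʳ p))

telescope : ∀ p q r → p ℚ.- r ≡ (p ℚ.- q) ℚ.+ (q ℚ.- r)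
telescope p q r = trans (cong (ℚ._- r) (sym ([p-q]+q≡p p q))) (ℚ.+-assoc (p ℚ.- q) q (ℚ.- r))

neg-minus : ∀ p q → ℚ.- (p ℚ.- q) ≡ q ℚ.- p
neg-minus p q = trans (ℚ.neg-distrib-+ p (ℚ.- q))
               (trans (cong (ℚ.- p ℚ.+_) (⁻¹-involutive q)) (ℚ.+-comm (ℚ.- p) q))

minus-+ : ∀ p q r s → (p ℚ.+ q) ℚ.- (r ℚ.+ s) ≡ (p ℚ.- r) ℚ.+ (q ℚ.- s)
minus-+ p q r s = trans (cong (p ℚ.+ q ℚ.+_) (ℚ.neg-distrib-+ r s)) (interchange p q (ℚ.- r) (ℚ.- s))

minus-* : ∀ p q r s → p ℚ.* q ℚ.- r ℚ.* s ≡ (p ℚ.- r) ℚ.* q ℚ.+ (q ℚ.- s) ℚ.* r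
minus-* p q r s = trans (telescope (p ℚ.* q) (r ℚ.* q) (r ℚ.* s)) (cong₂ ℚ._+_
  (trans (cong (p ℚ.* q ℚ.+_) (ℚ.neg-distribˡ-* r q)) (sym (ℚ.*-distribʳ-+ q p (ℚ.- r))))
  (trans (cong (r ℚ.* q ℚ.+_) (ℚ.neg-distribʳ-* r s))
  (trans (sym (ℚ.*-distribˡ-+ r q (ℚ.- s))) (ℚ.*-comm r (q ℚ.- s)))))

+-cauchy : ∀ {x y} → Cauchy x → Cauchy y → Cauchy (λ i → x i ℚ.+ y i)
+-cauchy {x} {y} cx cy {ε} 0<ε = M ⊔ N , λ {i} {j} i≥ j≥ → begin-strict
    ∣ (x i ℚ.+ y i) ℚ.- (x j ℚ.+ y j) ∣
      ≡⟨ cong ∣_∣ (minus-+ (x i) (y i) (x j) (y j)) ⟩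
    ∣ (x i ℚ.- x j) ℚ.+ (y i ℚ.- y j) ∣      ≤⟨ ℚ.∣p+q∣≤∣p∣+∣q∣ (x i ℚ.- x j) (y i ℚ.- y j) ⟩
    ∣ x i ℚ.- x j ∣ ℚ.+ ∣ y i ℚ.- y j ∣
      <⟨ ℚ.+-mono-< (hM (ℕ.m⊔n≤o⇒m≤o M N i≥) (ℕ.m⊔n≤o⇒m≤o M N j≥))
                    (hN (ℕ.m⊔n≤o⇒n≤o M N i≥) (ℕ.m⊔n≤o⇒n≤o M N j≥)) ⟩
    ½ ℚ.* ε ℚ.+ ½ ℚ.* ε                      ≡⟨ ½+½ ε ⟩
    ε                                        ∎
  where
  open ℚ.≤-Reasoning
  M  = proj₁ (cx (0<½* 0<ε))
  hM = proj₂ (cx (0<½* 0<ε))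
  N  = proj₁ (cy (0<½* 0<ε))
  hN = proj₂ (cy (0<½* 0<ε))

bounded : ∀ {x} → Cauchy x →
  ∃ λ B → 0ℚ ℚ.< B × ∃ λ N → ∀ {i} → N ≤ i → ∣ x i ∣ ℚ.≤ B
bounded {x} cx = 1ℚ ℚ.+ ∣ x N ∣ , 0<B , N , λ {i} i≥ → begin
    ∣ x i ∣                          ≡⟨ cong ∣_∣ ([p-q]+q≡p (x i) (x N)) ⟨
    ∣ x i ℚ.- x N ℚ.+ x N ∣          ≤⟨ ℚ.∣p+q∣≤∣p∣+∣q∣ (x i ℚ.- x N) (x N) ⟩
    ∣ x i ℚ.- x N ∣ ℚ.+ ∣ x N ∣      ≤⟨ ℚ.+-monoˡ-≤ ∣ x N ∣ (ℚ.<⇒≤ (hN i≥ ℕ.≤-refl)) ⟩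
    1ℚ ℚ.+ ∣ x N ∣                   ∎
  where
  open ℚ.≤-Reasoning
  0<1 : 0ℚ ℚ.< 1ℚ
  0<1 = ℚ.positive⁻¹ 1ℚ
  N  = proj₁ (cx 0<1)
  hN = proj₂ (cx 0<1)
  0<B : 0ℚ ℚ.< 1ℚ ℚ.+ ∣ x N ∣
  0<B = ℚ.+-mono-<-≤ 0<1 (ℚ.0≤∣p∣ (x N))

shrink : ∀ {ε B} → 0ℚ ℚ.< ε → 0ℚ ℚ.< B → ∃ λ η → 0ℚ ℚ.< η × η ℚ.* B ≡ ½ ℚ.* ε
shrink {ε} {B} 0<ε 0<B = η , 0<η , ηB
  where
  instance
    B-pos     = ℚ.positive 0<B
    B-nonZero = ℚ.pos⇒nonZero B
  η  = ½ ℚ.* ε ℚ.* ℚ.1/ B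
  ηB : η ℚ.* B ≡ ½ ℚ.* ε
  ηB = trans (ℚ.*-assoc (½ ℚ.* ε) (ℚ.1/ B) B)
      (trans (cong (½ ℚ.* ε ℚ.*_) (ℚ.*-inverseˡ B)) (ℚ.*-identityʳ (½ ℚ.* ε)))
  0<η : 0ℚ ℚ.< η
  0<η = ℚ.*-cancelʳ-<-nonNeg B ⦃ ℚ.pos⇒nonNeg B ⦄
          (subst₂ ℚ._<_ (sym (ℚ.*-zeroˡ B)) (sym ηB) (0<½* 0<ε))

*-cauchy : ∀ {x y} → Cauchy x → Cauchy y → Cauchy (λ i → x i ℚ.* y i)
*-cauchy {x} {y} cx cy {ε} 0<ε
  with A , 0<A , I , hA ← bounded cx
     | B , 0<B , J , hB ← bounded cy
  with η , 0<η , ηB ← shrink 0<ε 0<B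
     | θ , 0<θ , θA ← shrink 0<ε 0<A
  with M , hM ← cx 0<η
     | N , hN ← cy 0<θ
  = (I ⊔ J) ⊔ (M ⊔ N) , λ {i} {j} i≥ j≥ →
    let i≥MN = ℕ.m⊔n≤o⇒n≤o (I ⊔ J) (M ⊔ N) i≥
        j≥MN = ℕ.m⊔n≤o⇒n≤o (I ⊔ J) (M ⊔ N) j≥
        i≥J  = ℕ.m⊔n≤o⇒n≤o I J (ℕ.m⊔n≤o⇒m≤o (I ⊔ J) (M ⊔ N) i≥)
        j≥I  = ℕ.m⊔n≤o⇒m≤o I J (ℕ.m⊔n≤o⇒m≤o (I ⊔ J) (M ⊔ N) j≥)
    in begin-strict
    ∣ x i ℚ.* y i ℚ.- x j ℚ.* y j ∣
      ≡⟨ cong ∣_∣ (minus-* (x i) (y i) (x j) (y j)) ⟩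
    ∣ (x i ℚ.- x j) ℚ.* y i ℚ.+ (y i ℚ.- y j) ℚ.* x j ∣
      ≤⟨ ℚ.∣p+q∣≤∣p∣+∣q∣ ((x i ℚ.- x j) ℚ.* y i) ((y i ℚ.- y j) ℚ.* x j) ⟩
    ∣ (x i ℚ.- x j) ℚ.* y i ∣ ℚ.+ ∣ (y i ℚ.- y j) ℚ.* x j ∣
      <⟨ ℚ.+-mono-< (prod (x i ℚ.- x j) 0<B (hM (ℕ.m⊔n≤o⇒m≤o M N i≥MN) (ℕ.m⊔n≤o⇒m≤o M N j≥MN)) (hB i≥J))
                    (prod (y i ℚ.- y j) 0<A (hN (ℕ.m⊔n≤o⇒n≤o M N i≥MN) (ℕ.m⊔n≤o⇒n≤o M N j≥MN)) (hA j≥I)) ⟩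
    η ℚ.* B ℚ.+ θ ℚ.* A      ≡⟨ cong₂ ℚ._+_ ηB θA ⟩
    ½ ℚ.* ε ℚ.+ ½ ℚ.* ε      ≡⟨ ½+½ ε ⟩
    ε                        ∎
  where
  open ℚ.≤-Reasoning
  prod : ∀ p {q r s} → 0ℚ ℚ.< s → ∣ p ∣ ℚ.< r → ∣ q ∣ ℚ.≤ s → ∣ p ℚ.* q ∣ ℚ.< r ℚ.* s
  prod p {q} {r} {s} 0<s p<r q≤s = begin-strict
    ∣ p ℚ.* q ∣      ≡⟨ ℚ.∣p*q∣≡∣p∣*∣q∣ p q ⟩
    ∣ p ∣ ℚ.* ∣ q ∣  ≤⟨ ℚ.*-monoˡ-≤-nonNeg ∣ p ∣ ⦃ ℚ.∣-∣-nonNeg p ⦄ q≤s ⟩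
    ∣ p ∣ ℚ.* s      <⟨ ℚ.*-monoˡ-<-pos s ⦃ ℚ.positive 0<s ⦄ p<r ⟩
    r ℚ.* s          ∎

archimedean : ∀ {ε} → 0ℚ ℚ.< ε → ∃ λ N → ∀ {i} → N ≤ i → + 1 ℚ./ suc i ℚ.< ε
archimedean {ε@(mkℚ (+ suc a) b _)} 0<ε = suc b , λ {i} i≥ → ℚ.toℚᵘ-cancel-< (begin-strict
    ℚ.toℚᵘ (+ 1 ℚ./ suc i)  ≃⟨ ℚ.toℚᵘ-fromℚᵘ (ℚᵘ.mkℚᵘ (+ 1) i) ⟩
    ℚᵘ.mkℚᵘ (+ 1) i         <⟨ ℚᵘ.*<* (ℤ.+<+ (s≤s (less i≥))) ⟩
    ℚ.toℚᵘ ε                ∎)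
  where
  open ℚᵘ.≤-Reasoning
  less : ∀ {i} → suc b ≤ i → suc (b + 0) ≤ i + a * suc i
  less {i} h = ℕ.≤-trans (ℕ.≤-trans (ℕ.≤-reflexive (cong suc (ℕ.+-identityʳ b))) h) (ℕ.m≤m+n i _)
archimedean {mkℚ (+ zero) _ _}    (ℚ.*<* (ℤ.+<+ ()))
archimedean {mkℚ ℤ.-[1+ _ ] _ _} (ℚ.*<* ())

rate⇒cauchy : ∀ {x} → (∀ i j → x i ℚ.≤ x j ℚ.+ + 1 ℚ./ suc j) → Cauchy x
rate⇒cauchy {x} rate {ε} 0<ε with N , hN ← archimedean 0<ε =
    N , λ {i} {j} i≥ j≥ → close i j i≥ j≥
  where
  below : ∀ i j → N ≤ j → x i ℚ.- x j ℚ.< ε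
  below i j j≥ = begin-strict
      x i ℚ.- x j                      ≤⟨ ℚ.+-monoˡ-≤ (ℚ.- x j) (rate i j) ⟩
      x j ℚ.+ + 1 ℚ./ suc j ℚ.- x j    ≡⟨ xyx⁻¹≈y (x j) (+ 1 ℚ./ suc j) ⟩
      + 1 ℚ./ suc j                    <⟨ hN j≥ ⟩
      ε                                ∎
    where
    open ℚ.≤-Reasoning
  close : ∀ i j → N ≤ i → N ≤ j → ∣ x i ℚ.- x j ∣ ℚ.< ε
  close i j i≥ j≥ with ℚ.∣p∣≡p∨∣p∣≡-p (x i ℚ.- x j)
  ... | inj₁ e = subst (ℚ._< ε) (sym e) (below i j j≥)
  ... | inj₂ e = subst (ℚ._< ε) (sym (trans e (neg-minus (x i) (x j)))) (below j i i≥)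

_+ᴿ_ _*ᴿ_ : ℝ → ℝ → ℝ
x +ᴿ y = record { seq = λ i → seq x i ℚ.+ seq y i ; cauchy = +-cauchy {seq x} {seq y} (cauchy x) (cauchy y) }
x *ᴿ y = record { seq = λ i → seq x i ℚ.* seq y i ; cauchy = *-cauchy {seq x} {seq y} (cauchy x) (cauchy y) }

_^ᴿ_ : ℝ → ℕ → ℝ
x ^ᴿ zero  = fromℕᴿ 1
x ^ᴿ suc k = x *ᴿ x ^ᴿ k

-- ⌊√m⌋
isqrt : ℕ → ℕ
isqrt zero    = 0
isqrt (suc m) with suc (isqrt m) * suc (isqrt m) ℕ.≤? suc m
... | yes _ = suc (isqrt m)
... | no  _ = isqrt m

isqrt-spec : ∀ m → isqrt m * isqrt m ≤ m × m < suc (isqrt m) * suc (isqrt m)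
isqrt-spec zero = z≤n , s≤s z≤n
isqrt-spec (suc m) with isqrt-spec m | suc (isqrt m) * suc (isqrt m) ℕ.≤? suc m
... | lo , hi | yes k²≤ = k²≤ , ℕ.≤-<-trans hi
  (ℕ.*-mono-< {suc (isqrt m)} (ℕ.n<1+n _) (ℕ.n<1+n _))
... | lo , hi | no k²≰ = ℕ.m≤n⇒m≤1+n lo , ℕ.≰⇒> k²≰

cross : ∀ m a b → isqrt (m * (a * a)) * b ≤ suc (isqrt (m * (b * b))) * a
cross m a b with isqrt (m * (a * a)) | isqrt-spec (m * (a * a)) | isqrt (m * (b * b)) | isqrt-spec (m * (b * b))
... | p | lo , _ | q | _ , hi = ℕ.≮⇒≥ λ lt → ℕ.<-irrefl refl (begin-strict
    (suc q * a) * (suc q * a)  <⟨ ℕ.*-mono-< lt lt ⟩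
    (p * b) * (p * b)          ≡⟨ solve 2 (λ p b → (p :* b) :* (p :* b) := (p :* p) :* (b :* b)) refl p b ⟩
    (p * p) * (b * b)          ≤⟨ ℕ.*-monoˡ-≤ (b * b) lo ⟩
    (m * (a * a)) * (b * b)    ≡⟨ solve 3 (λ m a b → (m :* (a :* a)) :* (b :* b) := (m :* (b :* b)) :* (a :* a)) refl m a b ⟩
    (m * (b * b)) * (a * a)    ≤⟨ ℕ.*-monoˡ-≤ (a * a) (ℕ.<⇒≤ hi) ⟩
    (suc q * suc q) * (a * a)  ≡⟨ solve 2 (λ p b → (p :* p) :* (b :* b) := (p :* b) :* (p :* b)) refl (suc q) a ⟩
    (suc q * a) * (suc q * a)  ∎)
  where
  open ℕ.≤-Reasoning
  open +-*-Solver

-- ⌊√(m(i+1)²)⌋ / (i+1) lies within 1/(i+1) below √m.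
√-seq : ℕ → ℕ → ℚ
√-seq m i = + isqrt (m * (suc i * suc i)) ℚ./ suc i

√-rate : ∀ m i j → √-seq m i ℚ.≤ √-seq m j ℚ.+ + 1 ℚ./ suc j
√-rate m i j = ℚ.toℚᵘ-cancel-≤ (begin
    ℚ.toℚᵘ (√-seq m i)                 ≃⟨ ℚ.toℚᵘ-fromℚᵘ (ℚᵘ.mkℚᵘ (+ p) i) ⟩
    ℚᵘ.mkℚᵘ (+ p) i                    ≤⟨ ℚᵘ.*≤* (subst₂ ℤ._≤_ (ℤ.pos-* p (suc j)) (ℤ.pos-* (suc q) (suc i)) (ℤ.+≤+ (cross m (suc i) (suc j)))) ⟩
    ℚᵘ.mkℚᵘ (+ suc q) j                ≃⟨ ℚᵘ.*≡* eq ⟩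
    ℚᵘ.mkℚᵘ (+ q) j ℚᵘ.+ ℚᵘ.mkℚᵘ (+ 1) j
      ≃⟨ ℚᵘ.+-cong (ℚ.toℚᵘ-fromℚᵘ (ℚᵘ.mkℚᵘ (+ q) j)) (ℚ.toℚᵘ-fromℚᵘ (ℚᵘ.mkℚᵘ (+ 1) j)) ⟨
    ℚ.toℚᵘ (√-seq m j) ℚᵘ.+ ℚ.toℚᵘ (+ 1 ℚ./ suc j)
      ≃⟨ ℚ.toℚᵘ-homo-+ (√-seq m j) (+ 1 ℚ./ suc j) ⟨
    ℚ.toℚᵘ (√-seq m j ℚ.+ + 1 ℚ./ suc j)  ∎)
  where
  open ℚᵘ.≤-Reasoning
  p = isqrt (m * (suc i * suc i))
  q = isqrt (m * (suc j * suc j))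
  eq : + suc q ℤ.* + (suc j * suc j) ≡ (+ q ℤ.* + suc j ℤ.+ + 1 ℤ.* + suc j) ℤ.* + suc j
  eq = trans (cong (+ suc q ℤ.*_) (ℤ.pos-* (suc j) (suc j)))
      (trans (sym (ℤ.*-assoc (+ suc q) (+ suc j) (+ suc j)))
             (cong (ℤ._* + suc j) (trans (cong (ℤ._* + suc j) (cong +_ (sym (ℕ.+-comm q 1)))) (ℤ.*-distribʳ-+ (+ suc j) (+ q) (+ 1)))))

√ : ℕ → ℝ
√ m = record { seq = √-seq m ; cauchy = rate⇒cauchy (√-rate m) }

-- 𝔽₂ is the two-element ring of parities; 𝔽₂^ m is 𝔽₂^E for m edges.
𝔽₂^_ : ℕ → Set
𝔽₂^ m = Vec Parity m

_≟ⱽ_ : ∀ {m} → DecidableEquality (𝔽₂^ m)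
_≟ⱽ_ = Vec.≡-dec ℙ._≟_

∣_∣ⱽ : ∀ {m} → 𝔽₂^ m → ℕ
∣ z ∣ⱽ = count (ℙ._≟ 1ℙ) z

_·_ : ∀ {m} → 𝔽₂^ m → 𝔽₂^ m → Parity
s · z = Vec.foldr′ ℙ._+_ 0ℙ (zipWith ℙ._*_ s z)

combination : ∀ {m k} → 𝔽₂^ k → Vec (𝔽₂^ m) k → 𝔽₂^ m
combination {m} c vs =
  Vec.foldr′ (zipWith ℙ._+_) (replicate m 0ℙ) (zipWith (λ a → Vec.map (a ℙ.*_)) c vs)

words : ∀ {A : Set} → List A → ∀ t → List (Vec A t)
words as zero    = [] ∷ []
words as (suc t) = cartesianProductWith _∷_ as (words as t)

-- The span as a list without repetitions, so that a sum over this list is a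
-- sum over the subspace.
span : ∀ {m} → List (𝔽₂^ m) → List (𝔽₂^ m)
span vs = deduplicate _≟ⱽ_ (map (λ c → combination c (fromList vs)) (words (0ℙ ∷ 1ℙ ∷ []) (length vs)))

maxWeight : ∀ {m} → List (𝔽₂^ m) → ℕ
maxWeight W = max 0 (map ∣_∣ⱽ W)

-- A finite simple graph with vertex set Fin n and edge set Fin m.  Edge e
-- joins the vertices src e < tgt e; the strict order rules out loops, and
-- `simple` rules out multiple edges.
record Graph (n m : ℕ) : Set where
  field
    src tgt : Fin m → Fin n
    src<tgt : ∀ e → src e Fin.< tgt e
    simple  : ∀ {e f} → src e ≡ src f → tgt e ≡ tgt f → e ≡ f

-- (e , false) is e directed from src e to tgt e, and (e , true) its reversal.
Dart : ℕ → Set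
Dart m = Fin m × Bool

edge : ∀ {m} → Dart m → Fin m
edge = proj₁

reverse : ∀ {m} → Dart m → Dart m
reverse (e , b) = e , not b

_≟ᴰ_ : ∀ {m} → DecidableEquality (Dart m)
_≟ᴰ_ = ≡-dec Fin._≟_ Bool._≟_

darts : ∀ m → List (Dart m)
darts m = List.cartesianProduct (allFin m) (false ∷ true ∷ [])

walkParity : ∀ {m t} → Vec (Dart m) t → 𝔽₂^ m
walkParity w = tabulate λ e → parity (count (λ a → edge a Fin.≟ e) w)

module _ {n m : ℕ} (G : Graph n m) where
  open Graph G

  tail head : Dart m → Fin n
  tail (e , b) = if b then tgt e else src e
  head (e , b) = if b then src e else tgt e

  Follows : Dart m → Dart m → Set
  Follows a b = head a ≡ tail b × b ≢ reverse a

  Chain : ∀ {t} → Dart m → Vec (Dart m) t → Dart m → Set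
  Chain a []      z = Follows a z
  Chain a (b ∷ w) z = Follows a b × Chain b w z

  -- The last dart must be followed by the first.  A closed walk has a marked
  -- starting dart, so there are none of length 0.
  data ClosedNB : ∀ {t} → Vec (Dart m) t → Set where
    closed : ∀ {t a} {w : Vec (Dart m) t} → Chain a w a → ClosedNB (a ∷ w)

  chain? : ∀ {t} a (w : Vec (Dart m) t) z → Dec (Chain a w z)
  chain? a []      z = head a Fin.≟ tail z ×-dec ¬? (z ≟ᴰ reverse a)
  chain? a (b ∷ w) z = (head a Fin.≟ tail b ×-dec ¬? (b ≟ᴰ reverse a)) ×-dec chain? b w z

  closedNB? : ∀ {t} (w : Vec (Dart m) t) → Dec (ClosedNB w)
  closedNB? []      = no λ ()
  closedNB? (a ∷ w) = map′ closed (λ { (closed c) → c }) (chain? a w a)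

  -- N^nb_t(z)
  Nnb : ℕ → 𝔽₂^ m → ℕ
  Nnb t z = length (filter (λ w → closedNB? w ×-dec (walkParity w ≟ⱽ z)) (words (darts m) t))

  -- A cycle, traversed from a chosen start.  Its length is automatically at
  -- least 3, since G is simple and the traversal does not backtrack.
  record Cycle : Set where
    field
      len      : ℕ
      walk     : Vec (Dart m) len
      closedNB : ClosedNB walk
      distinct : Unique (Vec.map tail walk)

  open Cycle

  χ : Cycle → 𝔽₂^ m
  χ C = tabulate λ e → if does (VecAny.any? (λ a → edge a Fin.≟ e) (walk C)) then 1ℙ else 0ℙ

  EvenCycle : Cycle → Set
  EvenCycle C = 2 ∣ len C

  Consistent : List Cycle → Set
  Consistent 𝒞 = ∃ λ (s : 𝔽₂^ m) → ListAll.All (λ C → s · χ C ≡ 1ℙ) 𝒞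

  record Subgraph : Set where
    field
      V      : Subset n
      E      : Subset m
      src∈V  : ∀ {e} → e Subset.∈ E → src e Subset.∈ V
      tgt∈V  : ∀ {e} → e Subset.∈ E → tgt e Subset.∈ V

  whole : Subgraph
  whole = record { V = ⊤ ; E = ⊤ ; src∈V = λ _ → Subset.∈⊤ ; tgt∈V = λ _ → Subset.∈⊤ }

  module _ (H : Subgraph) where
    open Subgraph H

    Adjacent : Fin n → Fin n → Set
    Adjacent u v = ∃ λ a → edge a Subset.∈ E × tail a ≡ u × head a ≡ v

    Connected : Set
    Connected = Nonempty V × (∀ {u v} → u Subset.∈ V → v Subset.∈ V → Star Adjacent u v)

    degree : Fin n → ℕ
    degree v = length (filter
      (λ e → (e Subset.∈? E) ×-dec ((src e Fin.≟ v) ⊎-dec (tgt e Fin.≟ v))) (allFin m))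

    MinDegree≥2 : Set
    MinDegree≥2 = ∀ {v} → v Subset.∈ V → 2 ≤ degree v

    cycleRank : ℤ
    cycleRank = + Subset.∣ E ∣ ℤ.- + Subset.∣ V ∣ ℤ.+ + 1

    -- c_H(t)
    cnb : ℕ → ℕ
    cnb t = length (filter
      (λ w → closedNB? w ×-dec VecAll.all? (λ a → edge a Subset.∈? E) w) (words (darts m) t))

  Regular : ℕ → Set
  Regular d = ∀ v → degree whole v ≡ d

  Subcritical : ℕ → ℝ → ℕ → Set
  Subcritical r₀ δ ℓ = ∀ H → let E = Subgraph.E H in
    Connected H → MinDegree≥2 H → Subset.∣ E ∣ ≤ ℓ →
      cycleRank H ℤ.≤ + r₀
    × (∀ t → t ≤ 8 * ℓ →
         fromℕᴿ (cnb H t) ≤ᴿ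
           fromℕᴿ (2 * Subset.∣ E ∣) *ᴿ fromℕᴿ (t + 1) ^ᴿ (3 * r₀) *ᴿ (fromℕᴿ 1 +ᴿ δ) ^ᴿ t)

{-# OPTIONS --safe #-}

-- A closed non-backtracking walk of length ℓ with parity in W traverses each
-- edge outside a set of size at most Λ at least twice, so its support H has at
-- most (ℓ + Λ) / 2 edges, and H is connected with minimum degree at least 2.
-- Subcriticality then bounds the cycle rank of H by r₀ and the number of walks
-- supported on H by 2ℓ(ℓ+1)^(3r₀)(1+δ)^ℓ.  The supports themselves are counted
-- through the sequence of first traversals of edges along the walk: after
-- reaching a new vertex the walk must continue along a new edge, for which
-- there are d - 1 choices, and only a first traversal ending at an old vertex,
-- which closes a cycle, can be followed by a jump to some other visited vertex.
-- So there are at most r₀ jumps and O(n ℓ^(2r₀+1) (d-1)^((ℓ+Λ)/2)) supports.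
-- The exponents of ℓ and 1+δ in the claim leave room to spare, and C = 1 works.
module Submission where

open import Data.Bool.Base using (Bool; true; false; if_then_else_)
open import Data.Empty using (⊥)
open import Data.Fin.Base as Fin using (Fin; zero; suc)
import Data.Fin.Properties as Fin
open import Data.Fin.Subset as Subset using (Subset; inside; outside)
import Data.Fin.Subset.Properties as Subset
import Data.Integer.Base as ℤ
import Data.Integer.Properties as ℤ
import Data.Integer.Solver as ℤ
open import Data.List.Base using (List; []; _∷_; [_]; _++_; map; sum; length; filter; concatMap; take; upTo; allFin; cartesianProduct)
open import Data.List.Extrema.Nat using (xs≤max)
open import Data.List.Membership.Propositional using (_∈_; _∉_; lose)
open import Data.List.Membership.Propositional.Properties
import Data.List.Properties as List
open import Data.List.Properties using (length-map; length-++; length-take; take-all; length-tabulate; length-upTo)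
open import Data.List.Relation.Unary.All as All using (All; []; _∷_)
open import Data.List.Relation.Unary.All.Properties using (¬Any⇒All¬; map⁻)
open import Data.List.Relation.Unary.AllPairs using ([]; _∷_)
open import Data.List.Relation.Unary.Any using (here; there)
open import Data.List.Relation.Unary.Unique.DecPropositional.Properties using (deduplicate-!)
open import Data.List.Relation.Unary.Unique.Propositional using (Unique)
open import Data.Nat.Base
import Data.Nat.Properties as ℕ
open import Data.Nat.Solver using (module +-*-Solver)
open import Data.Parity.Base using (0ℙ; 1ℙ)
open import Data.Product using (∃; Σ-syntax; _×_; _,_; proj₁; proj₂)
open import Data.Rational.Base as ℚ using (ℚ; 0ℚ; 1ℚ; ½)
import Data.Rational.Properties as ℚ
import Data.Rational.Solver as ℚ
import Data.Rational.Unnormalised.Base as ℚᵘ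
import Data.Rational.Unnormalised.Properties as ℚᵘ
open import Data.Sum.Base using (_⊎_; inj₁; inj₂; [_,_]′)
open import Data.Unit.Base using (tt)
open import Data.Vec.Base as Vec using (Vec; []; _∷_; toList; tabulate; count; here; there)
import Data.Vec.Properties as Vec
import Data.Vec.Relation.Unary.All as VecAll
open import Data.Vec.Relation.Unary.All.Properties using (toList⁻)
open import Function using (_∘_; id)
open import Relation.Binary.Construct.Closure.ReflexiveTransitive as Star using (Star; _◅_; _◅◅_)
open import Relation.Binary.PropositionalEquality hiding ([_])
open import Relation.Nullary using (¬_; Dec; yes; no; does; ¬?; _×-dec_; contradiction)
open import Relation.Nullary.Decidable using (dec-true)
open import Relation.Unary using (Decidable)
open import Defs

-- Counting in filtered lists

module _ {A : Set} {P Q R : A → Set} (P? : Decidable P) (Q? : Decidable Q) (R? : Decidable R) where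

  length-filter-disjoint : (∀ {x} → P x → ¬ Q x) → (∀ {x} → P x → R x) → (∀ {x} → Q x → R x) →
    ∀ xs → length (filter P? xs) + length (filter Q? xs) ≤ length (filter R? xs)
  length-filter-disjoint dis P⇒R Q⇒R [] = z≤n
  length-filter-disjoint dis P⇒R Q⇒R (x ∷ xs)
    with ih ← length-filter-disjoint dis P⇒R Q⇒R xs | P? x | Q? x | R? x
  ... | yes p | yes q | _     = contradiction q (dis p)
  ... | yes p | no _  | yes _ = s≤s ih
  ... | yes p | no _  | no ¬r = contradiction (P⇒R p) ¬r
  ... | no _  | yes q | yes _ = ℕ.≤-trans (ℕ.≤-reflexive (ℕ.+-suc _ _)) (s≤s ih)
  ... | no _  | yes q | no ¬r = contradiction (Q⇒R q) ¬r
  ... | no _  | no _  | yes _ = ℕ.m≤n⇒m≤1+n ih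
  ... | no _  | no _  | no _  = ih

  length-filter-cover : (∀ {x} → R x → P x ⊎ Q x) →
    ∀ xs → length (filter R? xs) ≤ length (filter P? xs) + length (filter Q? xs)
  length-filter-cover cov [] = z≤n
  length-filter-cover cov (x ∷ xs)
    with ih ← length-filter-cover cov xs | P? x | Q? x | R? x
  ... | no ¬p | no ¬q | yes r = contradiction (cov r) [ ¬p , ¬q ]′
  ... | no _  | no _  | no _  = ih
  ... | yes _ | yes _ | no _  = ℕ.m≤n⇒m≤1+n (ℕ.≤-trans ih (ℕ.+-monoʳ-≤ _ (ℕ.n≤1+n _)))
  ... | yes _ | yes _ | yes _ = s≤s (ℕ.≤-trans ih (ℕ.+-monoʳ-≤ _ (ℕ.n≤1+n _)))
  ... | yes _ | no _  | no _  = ℕ.m≤n⇒m≤1+n ih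
  ... | yes _ | no _  | yes _ = s≤s ih
  ... | no _  | yes _ | no _  = ℕ.≤-trans ih (ℕ.+-monoʳ-≤ _ (ℕ.n≤1+n _))
  ... | no _  | yes _ | yes _ = ℕ.≤-trans (s≤s ih) (ℕ.≤-reflexive (sym (ℕ.+-suc _ _)))

length-filter-mono : ∀ {A : Set} {P Q : A → Set} (P? : Decidable P) (Q? : Decidable Q) →
  (∀ {x} → P x → Q x) → ∀ xs → length (filter P? xs) ≤ length (filter Q? xs)
length-filter-mono P? Q? P⇒Q [] = z≤n
length-filter-mono P? Q? P⇒Q (x ∷ xs)
  with ih ← length-filter-mono P? Q? P⇒Q xs | P? x | Q? x
... | yes p | yes _ = s≤s ih
... | yes p | no ¬q = contradiction (P⇒Q p) ¬q
... | no _  | yes _ = ℕ.m≤n⇒m≤1+n ih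
... | no _  | no _  = ih

module _ {A B : Set} {P : A → Set} (P? : Decidable P) (f : A → B) (_≟_ : ∀ (x y : B) → Dec (x ≡ y)) where
  open import Data.List.Membership.DecPropositional _≟_ using (_∈?_)

  fibre : List A → B → ℕ
  fibre xs y = length (filter (λ x → P? x ×-dec (f x ≟ y)) xs)

  -- Fibres over distinct values are disjoint; this is where the uniqueness of `ys` enters.
  sum-fibres≤ : ∀ {ys} → Unique ys → ∀ xs →
    sum (map (fibre xs) ys) ≤ length (filter (λ x → P? x ×-dec (f x ∈? ys)) xs)
  sum-fibres≤ [] xs = z≤n
  sum-fibres≤ (y∉ ∷ u) xs = ℕ.≤-trans (ℕ.+-monoʳ-≤ _ (sum-fibres≤ u xs))
    (length-filter-disjoint (λ x → P? x ×-dec (f x ≟ _)) (λ x → P? x ×-dec (f x ∈? _)) _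
      (λ { (_ , refl) (_ , f∈) → All.lookup y∉ f∈ refl })
      (λ { (p , e) → p , here e }) (λ { (p , e) → p , there e }) xs)

  -- A union bound: each kept element lies in the fibre of its own value, and is counted once per
  -- occurrence of that value in `ys`.
  ≤sum-fibres : ∀ ys xs →
    length (filter (λ x → P? x ×-dec (f x ∈? ys)) xs) ≤ sum (map (fibre xs) ys)
  ≤sum-fibres [] xs = ℕ.≤-trans
    (length-filter-mono (λ x → P? x ×-dec (f x ∈? [])) (λ _ → no λ ()) (λ { (_ , ()) }) xs) (none xs)
    where
    none : ∀ xs → length (filter {P = λ _ → ⊥} (λ _ → no λ ()) xs) ≤ 0
    none []       = z≤n
    none (_ ∷ xs) = none xs
  ≤sum-fibres (y ∷ ys) xs = ℕ.≤-trans
    (length-filter-cover (λ x → P? x ×-dec (f x ≟ y)) (λ x → P? x ×-dec (f x ∈? ys)) (λ x → P? x ×-dec (f x ∈? (y ∷ ys)))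
      (λ { (p , here e) → inj₁ (p , e) ; (p , there e) → inj₂ (p , e) }) xs)
    (ℕ.+-monoʳ-≤ _ (≤sum-fibres ys xs))

length-concatMap≤ : ∀ {A B : Set} (g : A → List B) {c} xs → (∀ {x} → x ∈ xs → length (g x) ≤ c) →
  length (concatMap g xs) ≤ length xs * c
length-concatMap≤ g []       h = z≤n
length-concatMap≤ g (x ∷ xs) h = ℕ.≤-trans (ℕ.≤-reflexive (length-++ (g x)))
  (ℕ.+-mono-≤ (h (here refl)) (length-concatMap≤ g xs (λ x∈ → h (there x∈))))

sum-map≤ : ∀ {A : Set} (g : A → ℕ) {c} xs → (∀ {x} → x ∈ xs → g x ≤ c) → sum (map g xs) ≤ length xs * c
sum-map≤ g []       h = z≤n
sum-map≤ g (x ∷ xs) h = ℕ.+-mono-≤ (h (here refl)) (sum-map≤ g xs (λ x∈ → h (there x∈)))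

-- Darts and degrees

module _ {A : Set} {Q : A × Bool → Set} {P : A → Set} (Q? : Decidable Q) (P? : Decidable P)
  (Q⇒P : ∀ {x b} → Q (x , b) → P x) (excl : ∀ {x} → Q (x , false) → ¬ Q (x , true)) where

  -- By `excl` an edge contributes at most one of its two orientations. This turns degrees, which
  -- count edges, into bounds on numbers of darts.
  length-filter-darts : ∀ xs → length (filter Q? (cartesianProduct xs (false ∷ true ∷ []))) ≤ length (filter P? xs)
  length-filter-darts [] = z≤n
  length-filter-darts (x ∷ xs) with ih ← length-filter-darts xs | Q? (x , false)
  ... | yes q₀ with Q? (x , true) | P? x
  ...   | yes q₁ | _     = contradiction q₁ (excl q₀)
  ...   | no _   | yes _ = s≤s ih
  ...   | no _   | no ¬p = contradiction (Q⇒P q₀) ¬p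
  length-filter-darts (x ∷ xs) | no _ with Q? (x , true) | P? x
  ...   | yes _  | yes _ = s≤s ih
  ...   | yes q₁ | no ¬p = contradiction (Q⇒P q₁) ¬p
  ...   | no _   | yes _ = ℕ.m≤n⇒m≤1+n ih
  ...   | no _   | no _  = ih

1≤length-filter : ∀ {A : Set} {P : A → Set} (P? : Decidable P) {x xs} → x ∈ xs → P x → 1 ≤ length (filter P? xs)
1≤length-filter P? x∈ p = ∈-length (∈-filter⁺ P? x∈ p)

∈-darts : ∀ {m} (a : Dart m) → a ∈ darts m
∈-darts (e , false) = ∈-cartesianProduct⁺ (∈-allFin e) (here refl)
∈-darts (e , true)  = ∈-cartesianProduct⁺ (∈-allFin e) (there (here refl))

module _ {n m : ℕ} (G : Graph n m) where
  open Graph G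

  src≢tgt : ∀ e → src e ≢ tgt e
  src≢tgt e = Fin.<⇒≢ (src<tgt e)

  tail≢head : ∀ a → tail G a ≢ head G a
  tail≢head (e , false) = src≢tgt e
  tail≢head (e , true)  = ≢-sym (src≢tgt e)

  tail-reverse : ∀ a → tail G (reverse a) ≡ head G a
  tail-reverse (e , false) = refl
  tail-reverse (e , true)  = refl

  out : Fin n → List (Dart m)
  out v = filter (λ b → v Fin.≟ tail G b) (darts m)

  next : Dart m → List (Dart m)
  next a = filter (λ b → (head G a Fin.≟ tail G b) ×-dec ¬? (b ≟ᴰ reverse a)) (darts m)

  length-out : ∀ {d} → Regular G d → ∀ v → length (out v) ≤ d
  length-out reg v = ℕ.≤-trans
    (length-filter-darts (λ b → v Fin.≟ tail G b) _
      (λ { {_} {false} e → Subset.∈⊤ , inj₁ (sym e) ; {_} {true} e → Subset.∈⊤ , inj₂ (sym e) })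
      (λ e e′ → src≢tgt _ (trans (sym e) e′)) (allFin m))
    (ℕ.≤-reflexive (reg v))

  -- `reverse a` itself leaves the head of `a`, so forbidding it removes one of at most `d`
  -- candidates.
  length-next : ∀ {d} → Regular G d → ∀ a → length (next a) ≤ d ∸ 1
  length-next {d} reg a = ℕ.m+n≤o⇒m≤o∸n _ (ℕ.≤-trans
    (ℕ.+-monoʳ-≤ (length (next a)) (1≤length-filter (_≟ᴰ reverse a) (∈-darts (reverse a)) refl))
    (ℕ.≤-trans
      (length-filter-disjoint (λ b → (head G a Fin.≟ tail G b) ×-dec ¬? (b ≟ᴰ reverse a)) (_≟ᴰ reverse a)
        (λ b → head G a Fin.≟ tail G b)
        (λ { (_ , ≢) ≡ → ≢ ≡ }) proj₁ (λ { refl → sym (tail-reverse a) }) (darts m))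
      (length-out reg (head G a))))

  -- The darts are split by their tails, one fibre per vertex.
  length-darts : ∀ {d} → Regular G d → length (darts m) ≤ n * d
  length-darts {d} reg = begin
    length (darts m)                                   ≤⟨ ℕ.≤-reflexive (sym (all-kept (darts m))) ⟩
    length (filter (λ a → yes _ ×-dec (tail G a ∈? allFin n)) (darts m))
      ≤⟨ ≤sum-fibres (λ _ → yes tt) (tail G) Fin._≟_ (allFin n) (darts m) ⟩
    sum (map (fibre (λ _ → yes tt) (tail G) Fin._≟_ (darts m)) (allFin n))
      ≤⟨ sum-map≤ _ (allFin n) (λ {v} _ → ℕ.≤-trans
           (length-filter-mono (λ a → yes tt ×-dec (tail G a Fin.≟ v)) (λ a → v Fin.≟ tail G a) (λ (_ , e) → sym e) (darts m))
           (length-out reg v)) ⟩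
    length (allFin n) * d                              ≡⟨ cong (_* d) (length-tabulate {n = n} (λ i → i)) ⟩
    n * d                                              ∎
    where
    open ℕ.≤-Reasoning
    open import Data.List.Membership.DecPropositional (Fin._≟_ {n}) using (_∈?_)
    all-kept : ∀ as → length (filter (λ a → yes tt ×-dec (tail G a ∈? allFin n)) as) ≡ length as
    all-kept [] = refl
    all-kept (a ∷ as) with tail G a ∈? allFin n
    ... | yes _ = cong suc (all-kept as)
    ... | no ∉  = contradiction (∈-allFin _) ∉

  -- Codes and their number

  endpoints : List (Dart m) → List (Fin n)
  endpoints []       = []
  endpoints (a ∷ as) = tail G a ∷ head G a ∷ endpoints as

  length-endpoints : ∀ as → length (endpoints as) ≡ 2 * length as
  length-endpoints []       = refl
  length-endpoints (a ∷ as) = trans (cong (λ k → 2 + k) (length-endpoints as)) (sym (ℕ.*-suc 2 (length as)))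

  -- The possible lists of first traversals along a walk, latest first, with at
  -- most r jumps.
  data Code : ℕ → List (Dart m) → Set where
    start  : ∀ {r a} → Code r (a ∷ [])
    follow : ∀ {r a b as} → Code r (a ∷ as) → Follows G a b → Code r (b ∷ a ∷ as)
    jump   : ∀ {r b as} → Code r as → tail G b ∈ endpoints as → Code (suc r) (b ∷ as)

  weaken : ∀ {r r′ as} → r ≤ r′ → Code r as → Code r′ as
  weaken le       start        = start
  weaken le       (follow c f) = follow (weaken le c) f
  weaken (s≤s le) (jump c v∈)  = jump (weaken le c) v∈

  extendFollowing : List (Dart m) → List (List (Dart m))
  extendFollowing []       = []
  extendFollowing (a ∷ as) = map (_∷ a ∷ as) (next a)

  -- Truncation at t bounds the number of extensions of every list; it is
  -- without effect on codes of length at most t / 2.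
  extendJumping : ℕ → List (Dart m) → List (List (Dart m))
  extendJumping t as = map (_∷ as) (concatMap out (take t (endpoints as)))

  -- The index `k` counts the steps after `start`, so the lists have length `suc k`. Repetitions are
  -- harmless, since the length is only bounded from above.
  codes : ℕ → ℕ → ℕ → List (List (Dart m))
  codes t zero    r       = map [_] (darts m)
  codes t (suc k) zero    = concatMap extendFollowing (codes t k zero)
  codes t (suc k) (suc r) = concatMap extendFollowing (codes t k (suc r)) ++ concatMap (extendJumping t) (codes t k r)

  ∈-extendFollowing : ∀ {a b as} → Follows G a b → b ∷ a ∷ as ∈ extendFollowing (a ∷ as)
  ∈-extendFollowing {b = b} f = ∈-map⁺ _ (∈-filter⁺ _ (∈-darts b) f)

  ∈-extendJumping : ∀ {b t} as → length (endpoints as) ≤ t → tail G b ∈ endpoints as → b ∷ as ∈ extendJumping t as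
  ∈-extendJumping {b} {t} as len v∈ = ∈-map⁺ _ (∈-concatMap⁺ out
    (lose (subst (tail G b ∈_) (sym (take-all t (endpoints as) len)) v∈) (∈-filter⁺ _ (∈-darts b) refl)))

  -- When a jump is appended, the list before it has at most `k` darts and so at most `2 * k`
  -- endpoints; under `2 * k ≤ t` none of them is cut off.
  ∈-codes : ∀ {t k r as} → Code r as → length as ≡ suc k → 2 * k ≤ t → as ∈ codes t k r
  ∈-codes {k = zero} {as = a ∷ []} c refl le = ∈-map⁺ [_] (∈-darts a)
  ∈-codes {k = suc k} {zero} (follow {as = as} c f) eq le =
    ∈-concatMap⁺ extendFollowing (lose (∈-codes c (ℕ.suc-injective eq) (ℕ.≤-trans (ℕ.*-monoʳ-≤ 2 (ℕ.n≤1+n k)) le)) (∈-extendFollowing f))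
  ∈-codes {k = suc k} {suc r} (follow {as = as} c f) eq le = ∈-++⁺ˡ (
    ∈-concatMap⁺ extendFollowing (lose (∈-codes c (ℕ.suc-injective eq) (ℕ.≤-trans (ℕ.*-monoʳ-≤ 2 (ℕ.n≤1+n k)) le)) (∈-extendFollowing f)))
  ∈-codes {t} {suc k} {suc r} (jump {as = as} c v∈) eq le = ∈-++⁺ʳ (concatMap extendFollowing (codes t k (suc r))) (
    ∈-concatMap⁺ (extendJumping t) (lose (∈-codes c (ℕ.suc-injective eq) (ℕ.≤-trans (ℕ.*-monoʳ-≤ 2 (ℕ.n≤1+n k)) le))
      (∈-extendJumping as (ℕ.≤-trans (ℕ.≤-reflexive (trans (length-endpoints as) (cong (2 *_) (ℕ.suc-injective eq)))) le) v∈)))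

  module _ {d : ℕ} (reg : Regular G d) where

    length-extendFollowing : ∀ as → length (extendFollowing as) ≤ d ∸ 1
    length-extendFollowing []       = z≤n
    length-extendFollowing (a ∷ as) = ℕ.≤-trans (ℕ.≤-reflexive (length-map _ (next a))) (length-next reg a)

    length-extendJumping : ∀ t as → length (extendJumping t as) ≤ t * d
    length-extendJumping t as = begin
      length (extendJumping t as)                        ≡⟨ length-map _ (concatMap out (take t (endpoints as))) ⟩
      length (concatMap out (take t (endpoints as)))     ≤⟨ length-concatMap≤ out (take t (endpoints as)) (λ _ → length-out reg _) ⟩
      length (take t (endpoints as)) * d                 ≡⟨ cong (_* d) (length-take t (endpoints as)) ⟩
      t ⊓ length (endpoints as) * d                      ≤⟨ ℕ.*-monoˡ-≤ d (ℕ.m⊓n≤m t _) ⟩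
      t * d                                              ∎
      where
      open ℕ.≤-Reasoning

    -- One step follows in at most `a = d ∸ 1` ways or jumps in at most `b = t * d` ways. As `a` is
    -- at least 1, `b` is at most `a * b`, so `a` factors out of both terms. What remains is
    -- `q * q ^ r + b * q ^ r`, at most `(q + b) ^ suc r`; hence a base that grows by `b` with each
    -- step.
    length-codes : 1 ≤ d ∸ 1 → ∀ t k r → length (codes t k r) ≤ n * d * (d ∸ 1) ^ k * (1 + k * (t * d)) ^ r
    length-codes 1≤a t zero r = begin
      length (map [_] (darts m))   ≡⟨ length-map [_] (darts m) ⟩
      length (darts m)             ≤⟨ length-darts reg ⟩
      n * d                        ≡⟨ sym (trans (cong₂ _*_ (ℕ.*-identityʳ (n * d)) (ℕ.^-zeroˡ r)) (ℕ.*-identityʳ (n * d))) ⟩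
      n * d * 1 * 1 ^ r            ∎
      where open ℕ.≤-Reasoning
    length-codes 1≤a t (suc k) zero = begin
      length (concatMap extendFollowing (codes t k 0))  ≤⟨ length-concatMap≤ extendFollowing (codes t k 0) (λ {as} _ → length-extendFollowing as) ⟩
      length (codes t k 0) * (d ∸ 1)                    ≤⟨ ℕ.*-monoˡ-≤ (d ∸ 1) (length-codes 1≤a t k 0) ⟩
      n * d * (d ∸ 1) ^ k * 1 * (d ∸ 1)
        ≡⟨ solve 3 (λ x p a → x :* p :* con 1 :* a := x :* (a :* p) :* con 1) refl (n * d) ((d ∸ 1) ^ k) (d ∸ 1) ⟩
      n * d * ((d ∸ 1) * (d ∸ 1) ^ k) * 1               ∎
      where
      open ℕ.≤-Reasoning
      open +-*-Solver
    length-codes 1≤a t (suc k) (suc r) = begin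
      length (concatMap extendFollowing (codes t k (suc r)) ++ concatMap (extendJumping t) (codes t k r))
        ≡⟨ length-++ (concatMap extendFollowing (codes t k (suc r))) ⟩
      length (concatMap extendFollowing (codes t k (suc r))) + length (concatMap (extendJumping t) (codes t k r))
        ≤⟨ ℕ.+-mono-≤ (length-concatMap≤ extendFollowing (codes t k (suc r)) (λ {as} _ → length-extendFollowing as))
                      (length-concatMap≤ (extendJumping t) (codes t k r) (λ {as} _ → length-extendJumping t as)) ⟩
      length (codes t k (suc r)) * a + length (codes t k r) * b
        ≤⟨ ℕ.+-mono-≤ (ℕ.*-monoˡ-≤ a (length-codes 1≤a t k (suc r)))
                      (ℕ.*-mono-≤ (length-codes 1≤a t k r) (ℕ.≤-trans (ℕ.≤-reflexive (sym (ℕ.*-identityˡ b))) (ℕ.*-monoˡ-≤ b 1≤a))) ⟩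
      x * p * (q * q ^ r) * a + x * p * q ^ r * (a * b)
        ≡⟨ solve 6 (λ x p q s a b → x :* p :* (q :* s) :* a :+ x :* p :* s :* (a :* b) := x :* (a :* p) :* ((q :+ b) :* s)) refl x p q (q ^ r) a b ⟩
      x * (a * p) * ((q + b) * q ^ r)
        ≤⟨ ℕ.*-monoʳ-≤ (x * (a * p)) (ℕ.*-mono-≤ (ℕ.≤-reflexive q+b) (ℕ.^-monoˡ-≤ r (ℕ.≤-trans (ℕ.m≤m+n q b) (ℕ.≤-reflexive q+b)))) ⟩
      x * (a * p) * ((1 + suc k * b) * (1 + suc k * b) ^ r)  ∎
      where
      open ℕ.≤-Reasoning
      open +-*-Solver
      x = n * d
      a = d ∸ 1
      b = t * d
      p = (d ∸ 1) ^ k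
      q = 1 + k * b
      q+b : q + b ≡ 1 + suc k * b
      q+b = cong suc (ℕ.+-comm (k * b) b)

  -- Codes of length `suc i` are listed at index `i`, so `upTo k` covers the lengths from 1 to `k`,
  -- and room for `2 * k` endpoints makes truncation ineffective for all of them.
  codesUpTo : ℕ → ℕ → List (List (Dart m))
  codesUpTo k r = concatMap (λ i → codes (2 * k) i r) (upTo k)

  ∈-codesUpTo : ∀ {k r as} → Code r as → length as ≤ k → as ∈ codesUpTo k r
  ∈-codesUpTo {k} {r} {a ∷ as} c le = ∈-concatMap⁺ (λ i → codes (2 * k) i r)
    (lose (∈-upTo⁺ le) (∈-codes c refl (ℕ.*-monoʳ-≤ 2 (ℕ.<⇒≤ le))))

  -- As `d ∸ 1` is at least 1, the bound on `codes` increases with the index, so its value at `k`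
  -- serves for each of the `k` lists.
  length-codesUpTo : ∀ {d} → Regular G d → 1 ≤ d ∸ 1 → ∀ k r →
    length (codesUpTo k r) ≤ k * (n * d * (d ∸ 1) ^ k * (1 + k * (2 * k * d)) ^ r)
  length-codesUpTo {d} reg 1≤a k r = ℕ.≤-trans
    (length-concatMap≤ (λ i → codes (2 * k) i r) (upTo k) (λ {i} i∈ → ℕ.≤-trans (length-codes reg 1≤a (2 * k) i r) (bound (ℕ.<⇒≤ (∈-upTo⁻ i∈)))))
    (ℕ.≤-reflexive (cong (_* (n * d * (d ∸ 1) ^ k * (1 + k * (2 * k * d)) ^ r)) (length-upTo k)))
    where
    instance a≢0 = >-nonZero 1≤a
    bound : ∀ {i} → i ≤ k →
      n * d * (d ∸ 1) ^ i * (1 + i * (2 * k * d)) ^ r ≤ n * d * (d ∸ 1) ^ k * (1 + k * (2 * k * d)) ^ r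
    bound i≤k = ℕ.*-mono-≤ (ℕ.*-monoʳ-≤ (n * d) (ℕ.^-monoʳ-≤ (d ∸ 1) i≤k)) (ℕ.^-monoˡ-≤ r (s≤s (ℕ.*-monoˡ-≤ (2 * k * d) i≤k)))

-- Lists and finite subsets

module _ {k : ℕ} where
  open import Data.List.Membership.DecPropositional (Fin._≟_ {k}) using (_∈?_) public

subset : ∀ {k} → List (Fin k) → Subset k
subset xs = tabulate (λ i → does (i ∈? xs))

∈-subset⁺ : ∀ {k} {xs : List (Fin k)} {i} → i ∈ xs → i Subset.∈ subset xs
∈-subset⁺ {xs = xs} {i} i∈ = Vec.lookup⇒[]= i (subset xs)
  (trans (Vec.lookup∘tabulate (λ j → does (j ∈? xs)) i) (dec-true (i ∈? xs) i∈))

∈-subset⁻ : ∀ {k} {xs : List (Fin k)} {i} → i Subset.∈ subset xs → i ∈ xs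
∈-subset⁻ {xs = xs} {i} i∈
  with i ∈? xs | trans (sym (Vec.lookup∘tabulate (λ j → does (j ∈? xs)) i)) (Vec.[]=⇒lookup i∈)
... | yes i∈xs | _ = i∈xs

length≤∣p∣ : ∀ {k} {xs : List (Fin k)} → Unique xs → (p : Subset k) → (∀ {i} → i ∈ xs → i Subset.∈ p) → length xs ≤ Subset.∣ p ∣
length≤∣p∣ []       p xs⊆p = z≤n
length≤∣p∣ {xs = x ∷ xs} (x∉ ∷ u) p xs⊆p = ℕ.≤-trans
  (s≤s (length≤∣p∣ u (p Subset.- x) (λ i∈ → Subset.x∈p∧x≢y⇒x∈p-y (xs⊆p (there i∈)) (≢-sym (All.lookup x∉ i∈)))))
  (Subset.x∈p⇒∣p-x∣<∣p∣ (xs⊆p (here refl)))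

∣p∣≤length : ∀ {k} (xs : List (Fin k)) (p : Subset k) → (∀ {i} → i Subset.∈ p → i ∈ xs) → Subset.∣ p ∣ ≤ length xs
∣p∣≤length {k} [] p p⊆xs = ℕ.≤-trans
  (Subset.p⊆q⇒∣p∣≤∣q∣ {p = p} {Subset.⊥} (λ i∈ → contradiction (p⊆xs i∈) (λ ())))
  (ℕ.≤-reflexive (Subset.∣⊥∣≡0 k))
∣p∣≤length (x ∷ xs) p p⊆xs = begin
  Subset.∣ p ∣                               ≤⟨ remove p x ⟩
  suc Subset.∣ p Subset.- x ∣                ≤⟨ s≤s (∣p∣≤length xs (p Subset.- x) (λ i∈ → rest i∈ (p⊆xs (Subset.p─q⊆p p Subset.⁅ x ⁆ i∈)))) ⟩
  suc (length xs)                            ∎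
  where
  open ℕ.≤-Reasoning
  x∉p-x : ∀ {k} (p : Subset k) x → x Subset.∉ p Subset.- x
  x∉p-x (inside  ∷ p) zero    ()
  x∉p-x (outside ∷ p) zero    ()
  x∉p-x (_ ∷ p)       (suc x) (there i∈) = x∉p-x p x i∈
  rest : ∀ {i} → i Subset.∈ p Subset.- x → i ∈ x ∷ xs → i ∈ xs
  rest i∈ (here refl) = contradiction i∈ (x∉p-x p x)
  rest _  (there i∈)  = i∈
  remove : ∀ {k} (p : Subset k) x → Subset.∣ p ∣ ≤ suc Subset.∣ p Subset.- x ∣
  remove (outside ∷ p) zero    = ℕ.m≤n⇒m≤1+n (ℕ.≤-reflexive (cong Subset.∣_∣ (sym (Subset.p─⊥≡p p))))
  remove (inside  ∷ p) zero    = s≤s (ℕ.≤-reflexive (cong Subset.∣_∣ (sym (Subset.p─⊥≡p p))))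
  remove (outside ∷ p) (suc x) = remove p x
  remove (inside  ∷ p) (suc x) = s≤s (remove p x)

-- Edge multiplicities and their parities

∑ : ∀ {k} → (Fin k → ℕ) → ℕ
∑ {zero}  f = 0
∑ {suc k} f = f zero + ∑ (f ∘ suc)

∑-0 : ∀ k → ∑ {k} (λ _ → 0) ≡ 0
∑-0 zero    = refl
∑-0 (suc k) = ∑-0 k

-- The conditional has the shape to which `count` unfolds on a cons, so that prepending a dart to a
-- walk is an instance.
∑-increment : ∀ {k} (i : Fin k) (f : Fin k → ℕ) → ∑ (λ j → (if does (i Fin.≟ j) then suc else id) (f j)) ≡ suc (∑ f)
∑-increment zero    f = refl
∑-increment (suc i) f = trans (cong (f zero +_) (∑-increment i (f ∘ suc))) (ℕ.+-suc (f zero) _)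

∑-traversals : ∀ {m t} (w : Vec (Dart m) t) → ∑ (λ e → count (λ a → edge a Fin.≟ e) w) ≡ t
∑-traversals {m} []      = ∑-0 m
∑-traversals     (a ∷ w) = trans (∑-increment (edge a) _) (cong suc (∑-traversals w))

-- An element of p of even multiplicity has multiplicity at least 2.
2∣p∣≤∑+odd : ∀ {k} (p : Subset k) (c : Fin k → ℕ) → (∀ {i} → i Subset.∈ p → 1 ≤ c i) →
  2 * Subset.∣ p ∣ ≤ ∑ c + ∣ tabulate (parity ∘ c) ∣ⱽ
2∣p∣≤∑+odd [] c pos = z≤n
2∣p∣≤∑+odd (outside ∷ p) c pos = ℕ.≤-trans
  (2∣p∣≤∑+odd p (c ∘ suc) (λ i∈ → pos (there i∈)))
  (ℕ.+-mono-≤ (ℕ.m≤n+m (∑ (c ∘ suc)) (c zero)) (∣z∣≤∣x∷z∣ (parity (c zero)) (tabulate (parity ∘ c ∘ suc))))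
  where
  ∣z∣≤∣x∷z∣ : ∀ {k} x (z : 𝔽₂^ k) → ∣ z ∣ⱽ ≤ ∣ x ∷ z ∣ⱽ
  ∣z∣≤∣x∷z∣ 0ℙ z = ℕ.≤-refl
  ∣z∣≤∣x∷z∣ 1ℙ z = ℕ.n≤1+n _
2∣p∣≤∑+odd (inside ∷ p) c pos = begin
  2 * suc Subset.∣ p ∣                                  ≡⟨ ℕ.*-suc 2 Subset.∣ p ∣ ⟩
  2 + 2 * Subset.∣ p ∣                                  ≤⟨ ℕ.+-monoʳ-≤ 2 (2∣p∣≤∑+odd p (c ∘ suc) (λ i∈ → pos (there i∈))) ⟩
  2 + (∑ (c ∘ suc) + ∣ tabulate (parity ∘ c ∘ suc) ∣ⱽ)  ≤⟨ first (c zero) (pos here) (∑ (c ∘ suc)) (tabulate (parity ∘ c ∘ suc)) ⟩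
  c zero + ∑ (c ∘ suc) + ∣ parity (c zero) ∷ tabulate (parity ∘ c ∘ suc) ∣ⱽ  ∎
  where
  open ℕ.≤-Reasoning
  first : ∀ {k} x → 1 ≤ x → ∀ s (z : 𝔽₂^ k) → 2 + (s + ∣ z ∣ⱽ) ≤ x + s + ∣ parity x ∷ z ∣ⱽ
  first 1             _ s z = ℕ.≤-reflexive (cong suc (sym (ℕ.+-suc s ∣ z ∣ⱽ)))
  first (suc (suc x)) _ s z with parity x
  ... | 0ℙ = s≤s (s≤s (ℕ.+-monoˡ-≤ ∣ z ∣ⱽ (ℕ.m≤n+m s x)))
  ... | 1ℙ = s≤s (s≤s (ℕ.+-mono-≤ (ℕ.m≤n+m s x) (ℕ.n≤1+n ∣ z ∣ⱽ)))

-- First traversals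

edge≡⇒ : ∀ {m} (a b : Dart m) → edge a ≡ edge b → a ≡ b ⊎ a ≡ reverse b
edge≡⇒ (_ , false) (_ , false) refl = inj₁ refl
edge≡⇒ (_ , false) (_ , true)  refl = inj₂ refl
edge≡⇒ (_ , true) (_ , false) refl = inj₂ refl
edge≡⇒ (_ , true) (_ , true) refl = inj₁ refl

edges : ∀ {m t} → Vec (Dart m) t → List (Fin m)
edges w = map edge (toList w)

discover : ∀ {m} → Dart m → List (Dart m) → List (Dart m)
discover b as = if does (edge b ∈? map edge as) then as else b ∷ as

explore : ∀ {m t} → List (Dart m) → Vec (Dart m) t → List (Dart m)
explore as []      = as
explore as (b ∷ w) = explore (discover b as) w

firstTraversals : ∀ {m t} → Vec (Dart m) t → List (Dart m)
firstTraversals = explore []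

module _ {m : ℕ} where

  explore-unique : ∀ {t as} (w : Vec (Dart m) t) → Unique (map edge as) → Unique (map edge (explore as w))
  explore-unique []                 u = u
  explore-unique {as = as} (b ∷ w) u with edge b ∈? map edge as
  ... | yes _ = explore-unique w u
  ... | no b∉ = explore-unique w (¬Any⇒All¬ _ b∉ ∷ u)

  -- Together with `explore⁺` this recovers the support of a walk from its first traversals, so that
  -- walks with the same code share their support.
  explore⁻ : ∀ {t as e} (w : Vec (Dart m) t) → e ∈ map edge (explore as w) → e ∈ map edge as ⊎ e ∈ edges w
  explore⁻ []                e∈ = inj₁ e∈
  explore⁻ {as = as} (b ∷ w) e∈ with edge b ∈? map edge as
  ... | yes _ with explore⁻ w e∈
  ...   | inj₁ e∈as = inj₁ e∈as
  ...   | inj₂ e∈w  = inj₂ (there e∈w)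
  explore⁻ {as = as} (b ∷ w) e∈ | no _ with explore⁻ w e∈
  ...   | inj₁ (here e≡b)   = inj₂ (here e≡b)
  ...   | inj₁ (there e∈as) = inj₁ e∈as
  ...   | inj₂ e∈w          = inj₂ (there e∈w)

  explore⁺ : ∀ {t as e} (w : Vec (Dart m) t) → e ∈ map edge as ⊎ e ∈ edges w → e ∈ map edge (explore as w)
  explore⁺ []                (inj₁ e∈) = e∈
  explore⁺ {as = as} (b ∷ w) e∈ with edge b ∈? map edge as | e∈
  ... | yes _  | inj₁ e∈as         = explore⁺ w (inj₁ e∈as)
  ... | yes b∈ | inj₂ (here refl)  = explore⁺ w (inj₁ b∈)
  ... | yes _  | inj₂ (there e∈w)  = explore⁺ w (inj₂ e∈w)
  ... | no _   | inj₁ e∈as         = explore⁺ w (inj₁ (there e∈as))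
  ... | no _   | inj₂ (here e≡b)   = explore⁺ w (inj₁ (here e≡b))
  ... | no _   | inj₂ (there e∈w)  = explore⁺ w (inj₂ e∈w)

-- Jumps along a walk

module _ {n m : ℕ} (G : Graph n m) where
  open Graph G

  head-reverse : ∀ a → head G (reverse a) ≡ tail G a
  head-reverse (e , false) = refl
  head-reverse (e , true)  = refl

  edge⇒endpoints : ∀ {b} as → edge b ∈ map edge as → tail G b ∈ endpoints G as × head G b ∈ endpoints G as
  edge⇒endpoints {b} (a ∷ as) (here eq) with edge≡⇒ b a eq
  ... | inj₁ refl = here refl , there (here refl)
  ... | inj₂ refl = there (here (tail-reverse G a)) , here (head-reverse a)
  edge⇒endpoints (a ∷ as) (there b∈) with t∈ , h∈ ← edge⇒endpoints as b∈ = there (there t∈) , there (there h∈)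

  -- The inclusion makes the length of `us` an upper bound for the number of vertices met, which is
  -- the direction needed against the cycle rank.
  Covers : List (Fin n) → List (Dart m) → Set
  Covers us as = ∀ {v} → v ∈ endpoints G as → v ∈ us

  -- The state of a walk whose last dart is c, with first traversals as and
  -- visited vertices us.  At a fresh vertex the walk must continue along a new
  -- edge; otherwise it has a jump in hand.
  data State : List (Dart m) → Dart m → Set where
    fresh  : ∀ {j us as c} → Code G j (c ∷ as) → Covers us (c ∷ as) → head G c ∉ endpoints G as →
             j + length us ≤ 2 + length as → State (c ∷ as) c
    closed : ∀ {j us as c} → Code G j as → Covers us as → head G c ∈ endpoints G as →
             j + length us ≤ length as → State as c

  cover-∷ : ∀ {us as b} → tail G b ∈ us → head G b ∈ us → Covers us as → Covers us (b ∷ as)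
  cover-∷ t∈ h∈ cov (here refl)         = t∈
  cover-∷ t∈ h∈ cov (there (here refl)) = h∈
  cover-∷ t∈ h∈ cov (there (there v∈))  = cov v∈

  -- The bound `suc (length as)` counts the new edge `b`. If `b` ends at an old vertex, no vertex is
  -- added and a unit is left over for a later jump; if it ends at a new one, `us` grows and uses up
  -- that unit.
  enter : ∀ {j us as b} → Code G j (b ∷ as) → Covers us as → tail G b ∈ us →
    j + length us ≤ suc (length as) → State (b ∷ as) b
  enter {j} {us} {as} {b} c cov t∈ le with head G b ∈? us
  ... | yes h∈ = closed c (cover-∷ t∈ h∈ cov) (there (here refl)) le
  ... | no h∉  = fresh c (cover-∷ (there t∈) (here refl) (λ v∈ → there (cov v∈))) (λ v∈ → h∉ (cov v∈))
    (ℕ.≤-trans (ℕ.≤-reflexive (ℕ.+-suc j (length us))) (s≤s le))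

  -- At a fresh vertex no known edge can follow `c`: repeating `c` would need a loop, its reversal
  -- is backtracking, and an older edge would make the head of `c` an old vertex. In the closed
  -- state nothing changes, as both ends of a known edge are old.
  revisit : ∀ {as c b} → State as c → Follows G c b → edge b ∈ map edge as → State as b
  revisit {_} {c} {b} (fresh {as = as} _ _ h∉ _) (h≡t , b≢) (here eq) with edge≡⇒ b c eq
  ... | inj₁ refl = contradiction (sym h≡t) (tail≢head G b)
  ... | inj₂ eq′  = contradiction eq′ b≢
  revisit {b = b} (fresh {as = as} _ _ h∉ _) (h≡t , _) (there b∈) =
    contradiction (subst (_∈ endpoints G as) (sym h≡t) (proj₁ (edge⇒endpoints as b∈))) h∉
  revisit {as} (closed code cov _ le) _ b∈ = closed code cov (proj₂ (edge⇒endpoints as b∈)) le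

  -- From a fresh vertex the new dart follows the latest entry of the list. In the closed state `c`
  -- need not be that entry, so the new dart is recorded as a jump, paid for by the spare unit.
  visit : ∀ {as c b} → State as c → Follows G c b → State (b ∷ as) b
  visit (fresh code cov _ le) f@(h≡t , _) = enter (follow code f) cov (subst (_∈ _) h≡t (cov (there (here refl)))) le
  visit (closed code cov h∈ le) (h≡t , _) = enter (jump code (subst (_∈ _) h≡t h∈)) cov (subst (_∈ _) h≡t (cov h∈)) (s≤s le)

  step : ∀ {as c b} → State as c → Follows G c b → State (discover b as) b
  step {as} {b = b} s f with edge b ∈? map edge as
  ... | yes b∈ = revisit s f b∈
  ... | no _   = visit s f

  -- Written additively, `j` is at most the number of edges minus `length us` plus 1, which has the
  -- form of the cycle rank.
  Encoded : List (Dart m) → Set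
  Encoded as = ∃ λ j → ∃ λ us → Code G j as × Covers us as × j + length us ≤ 1 + length as

  state⇒encoded : ∀ {as c} → State as c → Encoded as
  state⇒encoded (fresh c cov _ le)  = _ , _ , c , cov , le
  state⇒encoded (closed c cov _ le) = _ , _ , c , cov , ℕ.m≤n⇒m≤1+n le

  explore-encoded : ∀ {t as c z} (w : Vec (Dart m) t) → State as c → Chain G c w z → Encoded (explore as w)
  explore-encoded []      s ch       = state⇒encoded s
  explore-encoded (b ∷ w) s (f , ch) = explore-encoded w (step s f) ch

  encoded : ∀ {t} {w : Vec (Dart m) t} → ClosedNB G w → Encoded (firstTraversals w)
  encoded (closed {a = a} {w} ch) = explore-encoded w
    -- One edge, two vertices and no jump: `0 + 2 ≤ 2 + 0`.
    (fresh {j = 0} {us = tail G a ∷ head G a ∷ []} start id (λ ()) ℕ.≤-refl) ch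

  -- The support of a closed walk

  module _ {t : ℕ} {w : Vec (Dart m) t} (cl : ClosedNB G w) where

    -- In `chain` the last dart is followed by `z`; closing the walk identifies `z` with its first
    -- dart.
    successor : ∀ {a} → a ∈ toList w → ∃ λ b → b ∈ toList w × Follows G a b
    successor = go cl
      where
      chain : ∀ {t a z} (w : Vec (Dart m) t) → Chain G a w z → ∀ {x} → x ∈ a ∷ toList w → ∃ λ b → (b ∈ toList w ⊎ b ≡ z) × Follows G x b
      chain []      f        (here refl) = _ , inj₂ refl , f
      chain (b ∷ w) (f , _)  (here refl) = b , inj₁ (here refl) , f
      chain (b ∷ w) (_ , ch) (there x∈) with chain w ch x∈
      ... | y , inj₁ y∈ , g = y , inj₁ (there y∈) , g
      ... | y , inj₂ y≡ , g = y , inj₂ y≡ , g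
      go : ∀ {t} {w : Vec (Dart m) t} → ClosedNB G w → ∀ {a} → a ∈ toList w → ∃ λ b → b ∈ toList w × Follows G a b
      go (closed {w = w} ch) a∈ with chain w ch a∈
      ... | y , inj₁ y∈ , g   = y , there y∈ , g
      ... | y , inj₂ refl , g = y , here refl , g

    predecessor : ∀ {b} → b ∈ toList w → ∃ λ a → a ∈ toList w × Follows G a b
    predecessor = go cl
      where
      chain : ∀ {t a z} (w : Vec (Dart m) t) → Chain G a w z → ∀ {x} → x ∈ toList w ⊎ x ≡ z → ∃ λ y → y ∈ a ∷ toList w × Follows G y x
      chain []      f        (inj₂ refl)        = _ , here refl , f
      chain (b ∷ w) (f , _)  (inj₁ (here refl)) = _ , here refl , f
      chain (b ∷ w) (_ , ch) (inj₁ (there x∈)) with y , y∈ , g ← chain w ch (inj₁ x∈) = y , there y∈ , g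
      chain (b ∷ w) (_ , ch) (inj₂ x≡) with y , y∈ , g ← chain w ch (inj₂ x≡) = y , there y∈ , g
      go : ∀ {t} {w : Vec (Dart m) t} → ClosedNB G w → ∀ {b} → b ∈ toList w → ∃ λ a → a ∈ toList w × Follows G a b
      go (closed {w = w} ch) (here refl) = chain w ch (inj₂ refl)
      go (closed {w = w} ch) (there b∈)  = chain w ch (inj₁ b∈)

    tail∈ : ∀ {a} → a ∈ toList w → tail G a ∈ map (tail G) (toList w)
    tail∈ = ∈-map⁺ (tail G)

    head∈ : ∀ {a} → a ∈ toList w → head G a ∈ map (tail G) (toList w)
    head∈ a∈ with b , b∈ , (h≡t , _) ← successor a∈ = subst (_∈ _) (sym h≡t) (tail∈ b∈)

    -- The tails already contain all endpoints, because the head of a dart is the tail of its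
    -- successor.
    walkGraph : Subgraph G
    walkGraph = record
      { V     = subset (map (tail G) (toList w))
      ; E     = subset (edges w)
      ; src∈V = λ e∈ → ∈-subset⁺ (proj₁ (ends (∈-subset⁻ e∈)))
      ; tgt∈V = λ e∈ → ∈-subset⁺ (proj₂ (ends (∈-subset⁻ e∈)))
      }
      where
      ends : ∀ {e} → e ∈ edges w → src e ∈ map (tail G) (toList w) × tgt e ∈ map (tail G) (toList w)
      ends e∈ with ∈-map⁻ edge e∈
      ... | (_ , false) , a∈ , refl = tail∈ a∈ , head∈ a∈
      ... | (_ , true)  , a∈ , refl = head∈ a∈ , tail∈ a∈

    open Subgraph walkGraph

    -- A vertex is the tail of some dart `b`, whose predecessor `a` arrives there. The edges of `a`
    -- and `b` differ: equal darts would form a loop and opposite ones would backtrack.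
    walkGraph-minDegree : MinDegree≥2 G walkGraph
    walkGraph-minDegree v∈ with ∈-map⁻ (tail G) (∈-subset⁻ v∈)
    ... | b , b∈ , refl with a , a∈ , (h≡t , b≢) ← predecessor b∈ =
      ℕ.≤-trans (ℕ.+-mono-≤ (1≤length-filter (Fin._≟ edge a) (∈-allFin (edge a)) refl)
                            (1≤length-filter (Fin._≟ edge b) (∈-allFin (edge b)) refl))
        (length-filter-disjoint (Fin._≟ edge a) (Fin._≟ edge b) _
          distinct
          (λ { refl → ∈-subset⁺ (∈-map⁺ edge a∈) , incident-head a h≡t })
          (λ { refl → ∈-subset⁺ (∈-map⁺ edge b∈) , incident-tail b })
          (allFin m))
      where
      incident-tail : ∀ b → src (edge b) ≡ tail G b ⊎ tgt (edge b) ≡ tail G b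
      incident-tail (_ , false) = inj₁ refl
      incident-tail (_ , true)  = inj₂ refl
      incident-head : ∀ a {v} → head G a ≡ v → src (edge a) ≡ v ⊎ tgt (edge a) ≡ v
      incident-head (_ , false) eq = inj₂ eq
      incident-head (_ , true)  eq = inj₁ eq
      distinct : ∀ {e} → e ≡ edge a → e ≢ edge b
      distinct e≡a e≡b with edge≡⇒ b a (trans (sym e≡b) e≡a)
      ... | inj₁ refl = tail≢head G b (sym h≡t)
      ... | inj₂ eq   = b≢ eq

    -- The walk itself leads from its start to every vertex, and adjacency is symmetric.
    walkGraph-connected : Connected G walkGraph
    walkGraph-connected = nonempty cl , λ u∈ v∈ → join (∈-map⁻ (tail G) (∈-subset⁻ u∈)) (∈-map⁻ (tail G) (∈-subset⁻ v∈))
      where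
      Adj : Fin n → Fin n → Set
      Adj = Adjacent G walkGraph
      adj-sym : ∀ {u v} → Adj u v → Adj v u
      adj-sym (a , e∈ , refl , refl) = reverse a , e∈ , tail-reverse G a , head-reverse a
      nonempty : ∀ {t} {w : Vec (Dart m) t} → ClosedNB G w → Subset.Nonempty (subset (map (tail G) (toList w)))
      nonempty (closed {a = a} {w} _) = tail G a , ∈-subset⁺ {xs = map (tail G) (toList (a ∷ w))} (here refl)
      chain : ∀ {t a z} (w : Vec (Dart m) t) → Chain G a w z → (∀ {x} → x ∈ a ∷ toList w → edge x Subset.∈ E) →
        ∀ {x} → x ∈ a ∷ toList w → Star Adj (tail G a) (tail G x)
      chain w       _        _  (here refl) = Star.ε
      chain (b ∷ w) (f , ch) E∋ (there x∈)  = (_ , E∋ (here refl) , refl , proj₁ f) ◅ chain w ch (λ y∈ → E∋ (there y∈)) x∈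
      from-start : ∀ {t} {w : Vec (Dart m) t} → ClosedNB G w → (∀ {x} → x ∈ toList w → edge x Subset.∈ E) →
        ∃ λ o → ∀ {x} → x ∈ toList w → Star Adj o (tail G x)
      from-start (closed {a = a} {w} ch) E∋ = tail G a , chain w ch E∋
      join : ∀ {u v} → ∃ (λ a → a ∈ toList w × u ≡ tail G a) → ∃ (λ b → b ∈ toList w × v ≡ tail G b) → Star Adj u v
      join (a , a∈ , refl) (b , b∈ , refl) with _ , path ← from-start cl (λ x∈ → ∈-subset⁺ (∈-map⁺ edge x∈)) =
        Star.reverse adj-sym (path a∈) ◅◅ path b∈

    -- The multiplicities sum to `t`, and the edges of odd multiplicity are the nonzero coordinates
    -- of the parity.
    2∣E∣≤ : 2 * Subset.∣ E ∣ ≤ t + ∣ walkParity w ∣ⱽ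
    2∣E∣≤ = subst (λ s → 2 * Subset.∣ E ∣ ≤ s + ∣ walkParity w ∣ⱽ) (∑-traversals w)
      (2∣p∣≤∑+odd E _ (λ e∈ → traversed w (∈-subset⁻ e∈)))
      where
      traversed : ∀ {t e} (w : Vec (Dart m) t) → e ∈ edges w → 1 ≤ count (λ a → edge a Fin.≟ e) w
      traversed {e = e} (a ∷ w) e∈ with edge a Fin.≟ e | e∈
      ... | yes _ | _          = s≤s z≤n
      ... | no ≢  | here e≡    = contradiction (sym e≡) ≢
      ... | no _  | there e∈w  = traversed w e∈w

    length-firstTraversals : length (firstTraversals w) ≤ Subset.∣ E ∣
    length-firstTraversals = ℕ.≤-trans (ℕ.≤-reflexive (sym (length-map edge (firstTraversals w))))
      (length≤∣p∣ (explore-unique w []) E (λ e∈ → ∈-subset⁺ ([ (λ ()) , id ]′ (explore⁻ w e∈))))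

    -- The cycle rank pays for the jumps: the inequality of `Encoded` is compared with the rank
    -- bound, and `length us`, which is at least the number of vertices, cancels.
    code-firstTraversals : ∀ {r} → cycleRank G walkGraph ℤ.≤ ℤ.+ r → Code G r (firstTraversals w)
    code-firstTraversals {r} rank≤r with j , us , code , cov , le ← encoded cl =
      weaken G (ℕ.+-cancelʳ-≤ (length us) j r (begin
        j + length us                  ≤⟨ le ⟩
        1 + length (firstTraversals w) ≤⟨ s≤s length-firstTraversals ⟩
        1 + Subset.∣ E ∣               ≤⟨ ℤ.drop‿+≤+ rank ⟩
        r + Subset.∣ V ∣               ≤⟨ ℕ.+-monoʳ-≤ r (∣p∣≤length us V (λ v∈ → visited cov (∈-map⁻ (tail G) (∈-subset⁻ v∈)))) ⟩
        r + length us                  ∎)) code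
      where
      open ℕ.≤-Reasoning
      visited : ∀ {us v} → Covers us (firstTraversals w) → ∃ (λ a → a ∈ toList w × v ≡ tail G a) → v ∈ us
      visited cov (a , a∈ , refl) = cov (proj₁ (edge⇒endpoints _ (explore⁺ w (inj₂ (∈-map⁺ edge a∈)))))
      -- Adding the number of vertices to both sides of the integer inequality makes it one of
      -- natural numbers.
      rank : ℤ.+ (1 + Subset.∣ E ∣) ℤ.≤ ℤ.+ (r + Subset.∣ V ∣)
      rank = subst (ℤ._≤ ℤ.+ (r + Subset.∣ V ∣))
        (solve 2 (λ x y → x :- y :+ con (ℤ.+ 1) :+ y := con (ℤ.+ 1) :+ x) refl (ℤ.+ Subset.∣ E ∣) (ℤ.+ Subset.∣ V ∣))
        (ℤ.+-monoˡ-≤ (ℤ.+ Subset.∣ V ∣) rank≤r)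
        where open ℤ.+-*-Solver

-- Natural numbers and fractions among the rationals

/-mono-≤ : ∀ p q i j → p * suc j ≤ q * suc i → ℤ.+ p ℚ./ suc i ℚ.≤ ℤ.+ q ℚ./ suc j
/-mono-≤ p q i j le = ℚ.toℚᵘ-cancel-≤ (begin
  ℚ.toℚᵘ (ℤ.+ p ℚ./ suc i)  ≃⟨ ℚ.toℚᵘ-fromℚᵘ (ℚᵘ.mkℚᵘ (ℤ.+ p) i) ⟩
  ℚᵘ.mkℚᵘ (ℤ.+ p) i         ≤⟨ ℚᵘ.*≤* (subst₂ ℤ._≤_ (ℤ.pos-* p (suc j)) (ℤ.pos-* q (suc i)) (ℤ.+≤+ le)) ⟩
  ℚᵘ.mkℚᵘ (ℤ.+ q) j         ≃⟨ ℚ.toℚᵘ-fromℚᵘ (ℚᵘ.mkℚᵘ (ℤ.+ q) j) ⟨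
  ℚ.toℚᵘ (ℤ.+ q ℚ./ suc j)  ∎)
  where open ℚᵘ.≤-Reasoning

fromℕ : ℕ → ℚ
fromℕ k = ℤ.+ k ℚ./ 1

fromℕ-mono : ∀ {x y} → x ≤ y → fromℕ x ℚ.≤ fromℕ y
fromℕ-mono {x} {y} le = /-mono-≤ x y 0 0 (ℕ.*-monoˡ-≤ 1 le)

0≤/ : ∀ p i → 0ℚ ℚ.≤ ℤ.+ p ℚ./ suc i
0≤/ p i = /-mono-≤ 0 p 0 i z≤n

fromℕ-* : ∀ x y → fromℕ (x * y) ≡ fromℕ x ℚ.* fromℕ y
fromℕ-* x y = ℚ.toℚᵘ-injective (begin
  ℚ.toℚᵘ (fromℕ (x * y))                           ≈⟨ ℚ.toℚᵘ-fromℚᵘ (ℚᵘ.mkℚᵘ (ℤ.+ (x * y)) 0) ⟩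
  ℚᵘ.mkℚᵘ (ℤ.+ (x * y)) 0                          ≈⟨ ℚᵘ.*≡* (cong (ℤ._* ℤ.+ 1) (ℤ.pos-* x y)) ⟩
  ℚᵘ.mkℚᵘ (ℤ.+ x) 0 ℚᵘ.* ℚᵘ.mkℚᵘ (ℤ.+ y) 0
    ≈⟨ ℚᵘ.*-cong (ℚ.toℚᵘ-fromℚᵘ (ℚᵘ.mkℚᵘ (ℤ.+ x) 0)) (ℚ.toℚᵘ-fromℚᵘ (ℚᵘ.mkℚᵘ (ℤ.+ y) 0)) ⟨
  ℚ.toℚᵘ (fromℕ x) ℚᵘ.* ℚ.toℚᵘ (fromℕ y)           ≈⟨ ℚ.toℚᵘ-homo-* (fromℕ x) (fromℕ y) ⟨
  ℚ.toℚᵘ (fromℕ x ℚ.* fromℕ y)                     ∎)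
  where open ℚᵘ.≃-Reasoning

fromℕ-+ : ∀ x y → fromℕ (x + y) ≡ fromℕ x ℚ.+ fromℕ y
fromℕ-+ x y = ℚ.toℚᵘ-injective (begin
  ℚ.toℚᵘ (fromℕ (x + y))                           ≈⟨ ℚ.toℚᵘ-fromℚᵘ (ℚᵘ.mkℚᵘ (ℤ.+ (x + y)) 0) ⟩
  ℚᵘ.mkℚᵘ (ℤ.+ (x + y)) 0
    ≈⟨ ℚᵘ.*≡* (cong (ℤ._* ℤ.+ 1) (trans (ℤ.pos-+ x y) (sym (cong₂ ℤ._+_ (ℤ.*-identityʳ (ℤ.+ x)) (ℤ.*-identityʳ (ℤ.+ y)))))) ⟩
  ℚᵘ.mkℚᵘ (ℤ.+ x) 0 ℚᵘ.+ ℚᵘ.mkℚᵘ (ℤ.+ y) 0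
    ≈⟨ ℚᵘ.+-cong (ℚ.toℚᵘ-fromℚᵘ (ℚᵘ.mkℚᵘ (ℤ.+ x) 0)) (ℚ.toℚᵘ-fromℚᵘ (ℚᵘ.mkℚᵘ (ℤ.+ y) 0)) ⟨
  ℚ.toℚᵘ (fromℕ x) ℚᵘ.+ ℚ.toℚᵘ (fromℕ y)           ≈⟨ ℚ.toℚᵘ-homo-+ (fromℕ x) (fromℕ y) ⟨
  ℚ.toℚᵘ (fromℕ x ℚ.+ fromℕ y)                     ∎)
  where open ℚᵘ.≃-Reasoning

/-*-cancel : ∀ p i → ℤ.+ p ℚ./ suc i ℚ.* fromℕ (suc i) ≡ fromℕ p
/-*-cancel p i = ℚ.toℚᵘ-injective (begin
  ℚ.toℚᵘ (ℤ.+ p ℚ./ suc i ℚ.* fromℕ (suc i))        ≈⟨ ℚ.toℚᵘ-homo-* (ℤ.+ p ℚ./ suc i) (fromℕ (suc i)) ⟩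
  ℚ.toℚᵘ (ℤ.+ p ℚ./ suc i) ℚᵘ.* ℚ.toℚᵘ (fromℕ (suc i))
    ≈⟨ ℚᵘ.*-cong (ℚ.toℚᵘ-fromℚᵘ (ℚᵘ.mkℚᵘ (ℤ.+ p) i)) (ℚ.toℚᵘ-fromℚᵘ (ℚᵘ.mkℚᵘ (ℤ.+ suc i) 0)) ⟩
  ℚᵘ.mkℚᵘ (ℤ.+ p) i ℚᵘ.* ℚᵘ.mkℚᵘ (ℤ.+ suc i) 0
    ≈⟨ ℚᵘ.*≡* (trans (ℤ.*-identityʳ _) (cong (λ k → ℤ.+ p ℤ.* ℤ.+ suc k) (sym (ℕ.*-identityʳ i)))) ⟩
  ℚᵘ.mkℚᵘ (ℤ.+ p) 0                                ≈⟨ ℚ.toℚᵘ-fromℚᵘ (ℚᵘ.mkℚᵘ (ℤ.+ p) 0) ⟨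
  ℚ.toℚᵘ (fromℕ p)                                 ∎)
  where open ℚᵘ.≃-Reasoning

-- Inequalities between reals

½*≤ : ∀ {ε} → 0ℚ ℚ.< ε → ½ ℚ.* ε ℚ.≤ ε
½*≤ {ε} 0<ε = begin
  ½ ℚ.* ε              ≡⟨ ℚ.+-identityʳ (½ ℚ.* ε) ⟨
  ½ ℚ.* ε ℚ.+ 0ℚ       ≤⟨ ℚ.+-monoʳ-≤ (½ ℚ.* ε) (ℚ.<⇒≤ (0<½* 0<ε)) ⟩
  ½ ℚ.* ε ℚ.+ ½ ℚ.* ε  ≡⟨ ½+½ ε ⟩
  ε                    ∎
  where open ℚ.≤-Reasoning

pointwise : ∀ {x y} → (∀ i → seq x i ℚ.≤ seq y i) → x ≤ᴿ y
pointwise {x} {y} le {ε} 0<ε = 0 , λ {i} _ → begin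
  seq x i             ≤⟨ le i ⟩
  seq y i             ≡⟨ ℚ.+-identityʳ (seq y i) ⟨
  seq y i ℚ.+ 0ℚ      ≤⟨ ℚ.+-monoʳ-≤ (seq y i) (ℚ.<⇒≤ 0<ε) ⟩
  seq y i ℚ.+ ε       ∎
  where open ℚ.≤-Reasoning

pointwise-≡ : ∀ {x y} → (∀ i → seq x i ≡ seq y i) → x ≤ᴿ y
pointwise-≡ {x} {y} eq = pointwise {x} {y} (λ i → ℚ.≤-reflexive (eq i))

≤ᴿ-refl : ∀ {x} → x ≤ᴿ x
≤ᴿ-refl {x} = pointwise-≡ {x} {x} (λ _ → refl)

≤ᴿ-trans : ∀ {x y z} → x ≤ᴿ y → y ≤ᴿ z → x ≤ᴿ z
≤ᴿ-trans {x} {y} {z} x≤y y≤z {ε} 0<ε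
  with M , hM ← x≤y (0<½* 0<ε) | N , hN ← y≤z (0<½* 0<ε) = M ⊔ N , λ {i} i≥ → begin
    seq x i                                ≤⟨ hM (ℕ.m⊔n≤o⇒m≤o M N i≥) ⟩
    seq y i ℚ.+ ½ ℚ.* ε                    ≤⟨ ℚ.+-monoˡ-≤ (½ ℚ.* ε) (hN (ℕ.m⊔n≤o⇒n≤o M N i≥)) ⟩
    seq z i ℚ.+ ½ ℚ.* ε ℚ.+ ½ ℚ.* ε        ≡⟨ ℚ.+-assoc (seq z i) (½ ℚ.* ε) (½ ℚ.* ε) ⟩
    seq z i ℚ.+ (½ ℚ.* ε ℚ.+ ½ ℚ.* ε)      ≡⟨ cong (seq z i ℚ.+_) (½+½ ε) ⟩
    seq z i ℚ.+ ε                          ∎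
  where open ℚ.≤-Reasoning

+ᴿ-mono-≤ : ∀ {x y u v} → x ≤ᴿ y → u ≤ᴿ v → x +ᴿ u ≤ᴿ y +ᴿ v
+ᴿ-mono-≤ {x} {y} {u} {v} x≤y u≤v {ε} 0<ε
  with M , hM ← x≤y (0<½* 0<ε) | N , hN ← u≤v (0<½* 0<ε) = M ⊔ N , λ {i} i≥ → begin
    seq x i ℚ.+ seq u i
      ≤⟨ ℚ.+-mono-≤ (hM (ℕ.m⊔n≤o⇒m≤o M N i≥)) (hN (ℕ.m⊔n≤o⇒n≤o M N i≥)) ⟩
    (seq y i ℚ.+ ½ ℚ.* ε) ℚ.+ (seq v i ℚ.+ ½ ℚ.* ε)
      ≡⟨ solve 3 (λ y v h → (y :+ h) :+ (v :+ h) := (y :+ v) :+ (h :+ h)) refl (seq y i) (seq v i) (½ ℚ.* ε) ⟩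
    (seq y i ℚ.+ seq v i) ℚ.+ (½ ℚ.* ε ℚ.+ ½ ℚ.* ε)
      ≡⟨ cong (seq y i ℚ.+ seq v i ℚ.+_) (½+½ ε) ⟩
    seq y i ℚ.+ seq v i ℚ.+ ε  ∎
  where
  open ℚ.≤-Reasoning
  open ℚ.+-*-Solver

-- Stronger than 0 ≤ᴿ x, so that multiplication by x is monotone termwise.
EventuallyNonNeg : ℝ → Set
EventuallyNonNeg x = ∃ λ N → ∀ {i} → N ≤ i → 0ℚ ℚ.≤ seq x i

*-nonNeg : ∀ {x y} → EventuallyNonNeg x → EventuallyNonNeg y → EventuallyNonNeg (x *ᴿ y)
*-nonNeg {x} {y} (M , hM) (N , hN) = M ⊔ N , λ {i} i≥ →
  subst (ℚ._≤ seq x i ℚ.* seq y i) (ℚ.*-zeroˡ (seq y i))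
    (ℚ.*-monoʳ-≤-nonNeg (seq y i) ⦃ ℚ.nonNegative (hN (ℕ.m⊔n≤o⇒n≤o M N i≥)) ⦄ (hM (ℕ.m⊔n≤o⇒m≤o M N i≥)))

fromℕᴿ-nonNeg : ∀ k → EventuallyNonNeg (fromℕᴿ k)
fromℕᴿ-nonNeg k = 0 , λ _ → 0≤/ k 0

^-nonNeg : ∀ {x} k → EventuallyNonNeg x → EventuallyNonNeg (x ^ᴿ k)
^-nonNeg zero        x≥0 = fromℕᴿ-nonNeg 1
^-nonNeg {x} (suc k) x≥0 = *-nonNeg {x} {x ^ᴿ k} x≥0 (^-nonNeg k x≥0)

√-nonNeg : ∀ a → EventuallyNonNeg (√ a)
√-nonNeg a = 0 , λ {i} _ → 0≤/ (isqrt (a * (suc i * suc i))) i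

0≤ᴿ : ∀ {x} → EventuallyNonNeg x → fromℕᴿ 0 ≤ᴿ x
0≤ᴿ {x} (N , h) {ε} 0<ε = N , λ {i} i≥ → ℚ.+-mono-≤ (h i≥) (ℚ.<⇒≤ 0<ε)

-- Multiplication by `z` magnifies the tolerance by at most an eventual bound `B` of its terms, so
-- `x ≤ᴿ y` is used with `η` such that `η * B` is half of `ε`.
*ᴿ-monoˡ-≤ : ∀ {x y} z → EventuallyNonNeg z → x ≤ᴿ y → x *ᴿ z ≤ᴿ y *ᴿ z
*ᴿ-monoˡ-≤ {x} {y} z (M , z≥0) x≤y {ε} 0<ε
  with B , 0<B , N , z≤B ← bounded (cauchy z)
  with η , 0<η , ηB ← shrink 0<ε 0<B
  with L , x≤y+η ← x≤y 0<η = L ⊔ (M ⊔ N) , λ {i} i≥ →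
    let i≥L = ℕ.m⊔n≤o⇒m≤o L (M ⊔ N) i≥
        i≥M = ℕ.m⊔n≤o⇒m≤o M N (ℕ.m⊔n≤o⇒n≤o L (M ⊔ N) i≥)
        i≥N = ℕ.m⊔n≤o⇒n≤o M N (ℕ.m⊔n≤o⇒n≤o L (M ⊔ N) i≥)
    in begin
    seq x i ℚ.* seq z i                          ≤⟨ ℚ.*-monoʳ-≤-nonNeg (seq z i) ⦃ ℚ.nonNegative (z≥0 i≥M) ⦄ (x≤y+η i≥L) ⟩
    (seq y i ℚ.+ η) ℚ.* seq z i                  ≡⟨ ℚ.*-distribʳ-+ (seq z i) (seq y i) η ⟩
    seq y i ℚ.* seq z i ℚ.+ η ℚ.* seq z i
      ≤⟨ ℚ.+-monoʳ-≤ (seq y i ℚ.* seq z i) (ℚ.*-monoˡ-≤-nonNeg η ⦃ ℚ.nonNegative (ℚ.<⇒≤ 0<η) ⦄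
           (subst (ℚ._≤ B) (ℚ.0≤p⇒∣p∣≡p (z≥0 i≥M)) (z≤B i≥N))) ⟩
    seq y i ℚ.* seq z i ℚ.+ η ℚ.* B              ≡⟨ cong (seq y i ℚ.* seq z i ℚ.+_) ηB ⟩
    seq y i ℚ.* seq z i ℚ.+ ½ ℚ.* ε              ≤⟨ ℚ.+-monoʳ-≤ (seq y i ℚ.* seq z i) (½*≤ 0<ε) ⟩
    seq y i ℚ.* seq z i ℚ.+ ε                    ∎
  where open ℚ.≤-Reasoning

*ᴿ-comm : ∀ x y → x *ᴿ y ≤ᴿ y *ᴿ x
*ᴿ-comm x y = pointwise-≡ {x *ᴿ y} {y *ᴿ x} (λ i → ℚ.*-comm (seq x i) (seq y i))

*ᴿ-mono-≤ : ∀ {x y u v} → EventuallyNonNeg u → EventuallyNonNeg y → x ≤ᴿ y → u ≤ᴿ v → x *ᴿ u ≤ᴿ y *ᴿ v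
*ᴿ-mono-≤ {x} {y} {u} {v} u≥0 y≥0 x≤y u≤v =
  ≤ᴿ-trans {x *ᴿ u} {y *ᴿ u} {y *ᴿ v} (*ᴿ-monoˡ-≤ {x} {y} u u≥0 x≤y)
  (≤ᴿ-trans {y *ᴿ u} {u *ᴿ y} {y *ᴿ v} (*ᴿ-comm y u)
  (≤ᴿ-trans {u *ᴿ y} {v *ᴿ y} {y *ᴿ v} (*ᴿ-monoˡ-≤ {u} {v} y y≥0 u≤v) (*ᴿ-comm v y)))

^ᴿ-monoˡ-≤ : ∀ {x y} k → EventuallyNonNeg x → EventuallyNonNeg y → x ≤ᴿ y → x ^ᴿ k ≤ᴿ y ^ᴿ k
^ᴿ-monoˡ-≤ zero            x≥0 y≥0 x≤y = ≤ᴿ-refl {fromℕᴿ 1}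
^ᴿ-monoˡ-≤ {x} {y} (suc k) x≥0 y≥0 x≤y =
  *ᴿ-mono-≤ {x} {y} {x ^ᴿ k} {y ^ᴿ k} (^-nonNeg {x} k x≥0) y≥0 x≤y (^ᴿ-monoˡ-≤ {x} {y} k x≥0 y≥0 x≤y)

1≤^ᴿ : ∀ {x} k → EventuallyNonNeg x → fromℕᴿ 1 ≤ᴿ x → fromℕᴿ 1 ≤ᴿ x ^ᴿ k
1≤^ᴿ zero        x≥0 1≤x = ≤ᴿ-refl {fromℕᴿ 1}
1≤^ᴿ {x} (suc k) x≥0 1≤x =
  *ᴿ-mono-≤ {fromℕᴿ 1} {x} {fromℕᴿ 1} {x ^ᴿ k} (fromℕᴿ-nonNeg 1) x≥0 1≤x (1≤^ᴿ {x} k x≥0 1≤x)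

x≤x^ᴿ : ∀ {x k} → 1 ≤ k → EventuallyNonNeg x → fromℕᴿ 1 ≤ᴿ x → x ≤ᴿ x ^ᴿ k
x≤x^ᴿ {x} {suc k} _ x≥0 1≤x = ≤ᴿ-trans {x} {x *ᴿ fromℕᴿ 1} {x *ᴿ x ^ᴿ k}
  (pointwise-≡ {x} {x *ᴿ fromℕᴿ 1} (λ i → sym (ℚ.*-identityʳ (seq x i))))
  (*ᴿ-mono-≤ {x} {x} {fromℕᴿ 1} {x ^ᴿ k} (fromℕᴿ-nonNeg 1) x≥0 (≤ᴿ-refl {x}) (1≤^ᴿ {x} k x≥0 1≤x))

^ᴿ-distrib-* : ∀ x y k i → seq ((x *ᴿ y) ^ᴿ k) i ≡ seq (x ^ᴿ k *ᴿ y ^ᴿ k) i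
^ᴿ-distrib-* x y zero    i = sym (ℚ.*-identityʳ 1ℚ)
^ᴿ-distrib-* x y (suc k) i = trans (cong (seq x i ℚ.* seq y i ℚ.*_) (^ᴿ-distrib-* x y k i))
  (solve 4 (λ a b c d → (a :* b) :* (c :* d) := (a :* c) :* (b :* d)) refl (seq x i) (seq y i) (seq (x ^ᴿ k) i) (seq (y ^ᴿ k) i))
  where open ℚ.+-*-Solver

fromℕᴿ-^ : ∀ x k i → seq (fromℕᴿ x ^ᴿ k) i ≡ fromℕ (x ^ k)
fromℕᴿ-^ x zero    i = refl
fromℕᴿ-^ x (suc k) i = trans (cong (fromℕ x ℚ.*_) (fromℕᴿ-^ x k i)) (sym (fromℕ-* x (x ^ k)))

fromℕᴿ-mono : ∀ {x y} → x ≤ y → fromℕᴿ x ≤ᴿ fromℕᴿ y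
fromℕᴿ-mono {x} {y} le = pointwise {fromℕᴿ x} {fromℕᴿ y} (λ _ → fromℕ-mono le)

-- Estimates for square roots

k≤isqrt : ∀ {a} k → 1 ≤ a → k ≤ isqrt (a * (k * k))
k≤isqrt {a} k 1≤a = ℕ.≮⇒≥ λ lt → ℕ.<-irrefl refl (begin-strict
  a * (k * k)                     <⟨ proj₂ (isqrt-spec (a * (k * k))) ⟩
  suc (isqrt (a * (k * k))) * suc (isqrt (a * (k * k)))  ≤⟨ ℕ.*-mono-≤ lt lt ⟩
  k * k                           ≡⟨ ℕ.*-identityˡ (k * k) ⟨
  1 * (k * k)                     ≤⟨ ℕ.*-monoˡ-≤ (k * k) 1≤a ⟩
  a * (k * k)                     ∎)
  where open ℕ.≤-Reasoning

1≤√ : ∀ {a} → 1 ≤ a → fromℕᴿ 1 ≤ᴿ √ a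
1≤√ {a} 1≤a = pointwise {fromℕᴿ 1} {√ a} λ i → /-mono-≤ 1 (isqrt (a * (suc i * suc i))) 0 i
  (ℕ.≤-trans (ℕ.≤-reflexive (ℕ.*-comm 1 (suc i))) (ℕ.*-monoˡ-≤ 1 (k≤isqrt (suc i) 1≤a)))

isqrt≤ : ∀ a k → isqrt (a * (k * k)) ≤ a * k
isqrt≤ a k with isqrt (a * (k * k)) | proj₁ (isqrt-spec (a * (k * k)))
... | p | p²≤ = ℕ.≮⇒≥ λ lt → ℕ.<-irrefl refl (begin-strict
  a * k * (a * k)    <⟨ ℕ.*-mono-< lt lt ⟩
  p * p              ≤⟨ p²≤ ⟩
  a * (k * k)        ≤⟨ ℕ.*-monoˡ-≤ (k * k) (a≤a*a a) ⟩
  a * a * (k * k)    ≡⟨ solve 2 (λ a k → a :* a :* (k :* k) := a :* k :* (a :* k)) refl a k ⟩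
  a * k * (a * k)    ∎)
  where
  open ℕ.≤-Reasoning
  open +-*-Solver
  a≤a*a : ∀ a → a ≤ a * a
  a≤a*a zero    = z≤n
  a≤a*a (suc a) = ℕ.m≤m*n (suc a) (suc a)

-- Expanding `(p + 1) * (p + 1)` leaves the excess `2 * p + 1`. As `p` is at most `a * k`, it is
-- linear in `k` and vanishes in the limit after division by `k * k`.
ak²≤ : ∀ a i → let k = suc i; p = isqrt (a * (k * k)) in a * k * k ≤ p * p + (2 * a + 1) * k
ak²≤ a i = begin
  a * k * k                       ≡⟨ ℕ.*-assoc a k k ⟩
  a * (k * k)                     ≤⟨ ℕ.<⇒≤ (proj₂ (isqrt-spec (a * (k * k)))) ⟩
  suc p * suc p                   ≡⟨ solve 1 (λ p → (con 1 :+ p) :* (con 1 :+ p) := p :* p :+ (con 2 :* p :+ con 1)) refl p ⟩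
  p * p + (2 * p + 1)             ≤⟨ ℕ.+-monoʳ-≤ (p * p) (ℕ.+-mono-≤ (ℕ.*-monoʳ-≤ 2 (isqrt≤ a k)) (s≤s z≤n)) ⟩
  p * p + (2 * (a * k) + k)       ≡⟨ solve 3 (λ p a k → p :* p :+ (con 2 :* (a :* k) :+ k) := p :* p :+ (con 2 :* a :+ con 1) :* k) refl p a k ⟩
  p * p + (2 * a + 1) * k         ∎
  where
  open ℕ.≤-Reasoning
  open +-*-Solver
  k = suc i
  p = isqrt (a * (k * k))

-- This is `ak²≤` divided by `k * k`; the two cancellations of `κ` clear the denominators. An error
-- term is present because the approximations lie below the root.
√-seq² : ∀ a i → fromℕ a ℚ.≤ √-seq a i ℚ.* √-seq a i ℚ.+ (ℤ.+ 1 ℚ./ suc i) ℚ.* fromℕ (2 * a + 1)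
√-seq² a i = ℚ.*-cancelʳ-≤-pos κ (ℚ.*-cancelʳ-≤-pos κ (begin
  fromℕ a ℚ.* κ ℚ.* κ                        ≡⟨ trans (cong (ℚ._* κ) (sym (fromℕ-* a k))) (sym (fromℕ-* (a * k) k)) ⟩
  fromℕ (a * k * k)                          ≤⟨ fromℕ-mono (ak²≤ a i) ⟩
  fromℕ (p * p + c * k)                      ≡⟨ trans (fromℕ-+ (p * p) (c * k)) (cong₂ ℚ._+_ (fromℕ-* p p) (fromℕ-* c k)) ⟩
  fromℕ p ℚ.* fromℕ p ℚ.+ fromℕ c ℚ.* κ
    ≡⟨ cong₂ (λ x y → x ℚ.* x ℚ.+ fromℕ c ℚ.* y) (sym (/-*-cancel p i)) (sym (trans (cong (ℚ._* κ) (/-*-cancel 1 i)) (ℚ.*-identityˡ κ))) ⟩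
  (q ℚ.* κ) ℚ.* (q ℚ.* κ) ℚ.+ fromℕ c ℚ.* (u ℚ.* κ ℚ.* κ)
    ≡⟨ solve 4 (λ q u c κ → (q :* κ) :* (q :* κ) :+ c :* (u :* κ :* κ) := (q :* q :+ u :* c) :* κ :* κ) refl q u (fromℕ c) κ ⟩
  (q ℚ.* q ℚ.+ u ℚ.* fromℕ c) ℚ.* κ ℚ.* κ    ∎))
  where
  open ℚ.≤-Reasoning
  open ℚ.+-*-Solver
  k = suc i
  p = isqrt (a * (k * k))
  c = 2 * a + 1
  q = √-seq a i
  u = ℤ.+ 1 ℚ./ suc i
  κ = fromℕ k
  instance κ-pos = ℚ.normalize-pos k 1

≤ᴿ-rate : ∀ {x y B} → 0ℚ ℚ.< B → (∀ i → seq x i ℚ.≤ seq y i ℚ.+ (ℤ.+ 1 ℚ./ suc i) ℚ.* B) → x ≤ᴿ y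
≤ᴿ-rate {x} {y} {B} 0<B le {ε} 0<ε with η , 0<η , ηB ← shrink 0<ε 0<B with N , u<η ← archimedean 0<η =
  N , λ {i} i≥ → begin
    seq x i                                      ≤⟨ le i ⟩
    seq y i ℚ.+ (ℤ.+ 1 ℚ./ suc i) ℚ.* B          ≤⟨ ℚ.+-monoʳ-≤ (seq y i) (ℚ.*-monoʳ-≤-nonNeg B ⦃ ℚ.nonNegative (ℚ.<⇒≤ 0<B) ⦄ (ℚ.<⇒≤ (u<η i≥))) ⟩
    seq y i ℚ.+ η ℚ.* B                          ≡⟨ cong (seq y i ℚ.+_) ηB ⟩
    seq y i ℚ.+ ½ ℚ.* ε                          ≤⟨ ℚ.+-monoʳ-≤ (seq y i) (½*≤ 0<ε) ⟩
    seq y i ℚ.+ ε                                ∎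
  where open ℚ.≤-Reasoning

a≤√² : ∀ a → fromℕᴿ a ≤ᴿ √ a *ᴿ √ a
a≤√² a = ≤ᴿ-rate {fromℕᴿ a} {√ a *ᴿ √ a} {fromℕ (2 * a + 1)}
  (ℚ.<-≤-trans {0ℚ} {1ℚ} {fromℕ (2 * a + 1)} (ℚ.positive⁻¹ 1ℚ) (fromℕ-mono {1} {2 * a + 1} (ℕ.m≤n+m 1 (2 * a)))) (√-seq² a)

-- Each factor `a` is absorbed by two factors `√ a`; the remaining ones are at least 1.
a^k≤√^ : ∀ {a} k ℓ → 1 ≤ a → 2 * k ≤ ℓ → fromℕᴿ (a ^ k) ≤ᴿ √ a ^ᴿ ℓ
a^k≤√^ {a} zero    ℓ             1≤a _  = 1≤^ᴿ {√ a} ℓ (√-nonNeg a) (1≤√ 1≤a)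
a^k≤√^ {a} (suc k) (suc zero)    1≤a (s≤s le) with () ← subst (_≤ 0) (ℕ.+-suc k (k + 0)) le
a^k≤√^ {a} (suc k) (suc (suc ℓ)) 1≤a le =
  ≤ᴿ-trans {fromℕᴿ (a * a ^ k)} {fromℕᴿ a *ᴿ fromℕᴿ (a ^ k)} {√ a *ᴿ (√ a *ᴿ √ a ^ᴿ ℓ)}
    (pointwise-≡ {fromℕᴿ (a * a ^ k)} {fromℕᴿ a *ᴿ fromℕᴿ (a ^ k)} (λ _ → fromℕ-* a (a ^ k)))
  (≤ᴿ-trans {fromℕᴿ a *ᴿ fromℕᴿ (a ^ k)} {(√ a *ᴿ √ a) *ᴿ √ a ^ᴿ ℓ} {√ a *ᴿ (√ a *ᴿ √ a ^ᴿ ℓ)}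
    (*ᴿ-mono-≤ {fromℕᴿ a} {√ a *ᴿ √ a} {fromℕᴿ (a ^ k)} {√ a ^ᴿ ℓ}
      (fromℕᴿ-nonNeg (a ^ k)) (*-nonNeg {√ a} {√ a} (√-nonNeg a) (√-nonNeg a)) (a≤√² a)
      (a^k≤√^ k ℓ 1≤a (ℕ.≤-pred (ℕ.≤-pred (subst (_≤ 2 + ℓ) (ℕ.*-suc 2 k) le)))))
    (pointwise-≡ {(√ a *ᴿ √ a) *ᴿ √ a ^ᴿ ℓ} {√ a *ᴿ (√ a *ᴿ √ a ^ᴿ ℓ)}
      (λ i → ℚ.*-assoc (√-seq a i) (√-seq a i) (seq (√ a ^ᴿ ℓ) i))))

-- Auxiliary sums and arithmetic

sum-bound : ∀ {A : Set} (f : A → ℕ) {B} → (∀ x → fromℕᴿ (f x) ≤ᴿ B) → ∀ xs →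
  fromℕᴿ (sum (map f xs)) ≤ᴿ fromℕᴿ (length xs) *ᴿ B
sum-bound f {B} f≤B []       = pointwise-≡ {fromℕᴿ 0} {fromℕᴿ 0 *ᴿ B} (λ i → sym (ℚ.*-zeroˡ (seq B i)))
sum-bound f {B} f≤B (x ∷ xs) =
  ≤ᴿ-trans {fromℕᴿ (f x + s)} {fromℕᴿ (f x) +ᴿ fromℕᴿ s} {fromℕᴿ (suc l) *ᴿ B}
    (pointwise-≡ {fromℕᴿ (f x + s)} {fromℕᴿ (f x) +ᴿ fromℕᴿ s} (λ _ → fromℕ-+ (f x) s))
  (≤ᴿ-trans {fromℕᴿ (f x) +ᴿ fromℕᴿ s} {B +ᴿ fromℕᴿ l *ᴿ B} {fromℕᴿ (suc l) *ᴿ B}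
    (+ᴿ-mono-≤ {fromℕᴿ (f x)} {B} {fromℕᴿ s} {fromℕᴿ l *ᴿ B} (f≤B x) (sum-bound f {B} f≤B xs))
    (pointwise-≡ {B +ᴿ fromℕᴿ l *ᴿ B} {fromℕᴿ (suc l) *ᴿ B} λ i → begin
      seq B i ℚ.+ fromℕ l ℚ.* seq B i              ≡⟨ cong (ℚ._+ fromℕ l ℚ.* seq B i) (ℚ.*-identityˡ (seq B i)) ⟨
      1ℚ ℚ.* seq B i ℚ.+ fromℕ l ℚ.* seq B i       ≡⟨ ℚ.*-distribʳ-+ (seq B i) 1ℚ (fromℕ l) ⟨
      (1ℚ ℚ.+ fromℕ l) ℚ.* seq B i                 ≡⟨ cong (ℚ._* seq B i) (fromℕ-+ 1 l) ⟨
      fromℕ (suc l) ℚ.* seq B i                    ∎))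
  where
  open ≡-Reasoning
  s = sum (map f xs)
  l = length xs

-- A count either vanishes or has a witness; a walk found in this way supplies a support to compare
-- with, and lower bounds on its length and on the degree.
filter-empty⊎witness : ∀ {A : Set} {P : A → Set} (P? : Decidable P) xs → length (filter P? xs) ≡ 0 ⊎ ∃ P
filter-empty⊎witness P? []       = inj₁ refl
filter-empty⊎witness P? (x ∷ xs) with P? x
... | yes p = inj₂ (x , p)
... | no _  = filter-empty⊎witness P? xs

^-distribʳ-* : ∀ k x y → (x * y) ^ k ≡ x ^ k * y ^ k
^-distribʳ-* zero    x y = refl
^-distribʳ-* (suc k) x y = trans (cong (x * y *_) (^-distribʳ-* k x y))
  (solve 4 (λ x y p q → (x :* y) :* (p :* q) := (x :* p) :* (y :* q)) refl x y (x ^ k) (y ^ k))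
  where open +-*-Solver

2*⌊n/2⌋≤n : ∀ n → 2 * ⌊ n /2⌋ ≤ n
2*⌊n/2⌋≤n n = begin
  2 * ⌊ n /2⌋             ≡⟨ cong (⌊ n /2⌋ +_) (ℕ.+-identityʳ ⌊ n /2⌋) ⟩
  ⌊ n /2⌋ + ⌊ n /2⌋       ≤⟨ ℕ.+-monoʳ-≤ ⌊ n /2⌋ (ℕ.⌊n/2⌋≤⌈n/2⌉ n) ⟩
  ⌊ n /2⌋ + ⌈ n /2⌉       ≡⟨ ℕ.⌊n/2⌋+⌈n/2⌉≡n n ⟩
  n                       ∎
  where open ℕ.≤-Reasoning

2*k≤n⇒k≤⌊n/2⌋ : ∀ {k n} → 2 * k ≤ n → k ≤ ⌊ n /2⌋
2*k≤n⇒k≤⌊n/2⌋ {k} {n} le = begin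
  k               ≡⟨ ℕ.n≡⌊n+n/2⌋ k ⟩
  ⌊ k + k /2⌋     ≡⟨ cong (λ j → ⌊ k + j /2⌋) (ℕ.+-identityʳ k) ⟨
  ⌊ 2 * k /2⌋     ≤⟨ ℕ.⌊n/2⌋-mono le ⟩
  ⌊ n /2⌋         ∎
  where open ℕ.≤-Reasoning

-- Walks with parity in the span

module _ {n m : ℕ} (G : Graph n m) where

  closed⇒1≤t : ∀ {t} {w : Vec (Dart m) t} → ClosedNB G w → 1 ≤ t
  closed⇒1≤t (closed _) = s≤s z≤n

  -- The successor of a dart `a` of the walk is a member of `next a`.
  closed⇒1≤d∸1 : ∀ {d t} {w : Vec (Dart m) t} → Regular G d → ClosedNB G w → 1 ≤ d ∸ 1
  closed⇒1≤d∸1 reg cl@(closed {a = a} _) with b , _ , f ← successor G cl (here refl) =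
    ℕ.≤-trans (1≤length-filter _ (∈-darts b) f) (length-next G reg a)

  module GoodWalks (r₀ ℓ Λ : ℕ) (δ : ℝ) (W : List (𝔽₂^ m)) (0≤1+δ : EventuallyNonNeg (fromℕᴿ 1 +ᴿ δ)) (Λ≤ℓ : Λ ≤ ℓ)
    (sub : Subcritical G r₀ δ ℓ) (W≤Λ : ∀ {z} → z ∈ W → ∣ z ∣ⱽ ≤ Λ) where

    open import Data.List.Membership.DecPropositional (_≟ⱽ_ {m}) renaming (_∈?_ to _∈ⱽ?_) using ()
    open import Data.List.Membership.DecPropositional (List.≡-dec (_≟ᴰ_ {m})) renaming (_∈?_ to _∈ᶜ?_) using ()

    Good : Vec (Dart m) ℓ → Set
    Good w = ClosedNB G w × walkParity w ∈ W

    good? : Decidable Good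
    good? w = closedNB? G w ×-dec (walkParity w ∈ⱽ? W)

    -- The subcriticality bound at length `ℓ` with the number of edges replaced by `ℓ`, which makes
    -- it the same for all supports.
    bound : ℝ
    bound = fromℕᴿ (2 * ℓ) *ᴿ fromℕᴿ (ℓ + 1) ^ᴿ (3 * r₀) *ᴿ (fromℕᴿ 1 +ᴿ δ) ^ᴿ ℓ

    bound≥0 : EventuallyNonNeg bound
    bound≥0 = *-nonNeg {fromℕᴿ (2 * ℓ) *ᴿ fromℕᴿ (ℓ + 1) ^ᴿ (3 * r₀)} {(fromℕᴿ 1 +ᴿ δ) ^ᴿ ℓ}
      (*-nonNeg {fromℕᴿ (2 * ℓ)} {fromℕᴿ (ℓ + 1) ^ᴿ (3 * r₀)} (fromℕᴿ-nonNeg (2 * ℓ))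
        (^-nonNeg {fromℕᴿ (ℓ + 1)} (3 * r₀) (fromℕᴿ-nonNeg (ℓ + 1))))
      (^-nonNeg {fromℕᴿ 1 +ᴿ δ} ℓ 0≤1+δ)

    module _ {w : Vec (Dart m) ℓ} (cl : ClosedNB G w) (z∈ : walkParity w ∈ W) where
      open Subgraph (walkGraph G cl)

      2∣E∣≤ℓ+Λ : 2 * Subset.∣ E ∣ ≤ ℓ + Λ
      2∣E∣≤ℓ+Λ = ℕ.≤-trans (2∣E∣≤ G cl) (ℕ.+-monoʳ-≤ ℓ (W≤Λ z∈))

      -- Here `Λ≤ℓ` keeps the support within the scale of subcriticality.
      ∣E∣≤ℓ : Subset.∣ E ∣ ≤ ℓ
      ∣E∣≤ℓ = ℕ.*-cancelˡ-≤ 2 (ℕ.≤-trans 2∣E∣≤ℓ+Λ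
        (ℕ.+-monoʳ-≤ ℓ (ℕ.≤-trans Λ≤ℓ (ℕ.m≤m+n ℓ 0))))

      private
        subcritical = sub (walkGraph G cl) (walkGraph-connected G cl) (walkGraph-minDegree G cl) ∣E∣≤ℓ

      firstTraversals∈codes : firstTraversals w ∈ codesUpTo G ⌊ ℓ + Λ /2⌋ r₀
      firstTraversals∈codes = ∈-codesUpTo G (code-firstTraversals G cl (proj₁ subcritical))
        (ℕ.≤-trans (length-firstTraversals G cl) (2*k≤n⇒k≤⌊n/2⌋ 2∣E∣≤ℓ+Λ))

      cnb-walkGraph : fromℕᴿ (cnb G (walkGraph G cl) ℓ) ≤ᴿ bound
      cnb-walkGraph = ≤ᴿ-trans {fromℕᴿ (cnb G (walkGraph G cl) ℓ)} {fromℕᴿ (2 * Subset.∣ E ∣) *ᴿ Y *ᴿ Z} {fromℕᴿ (2 * ℓ) *ᴿ Y *ᴿ Z}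
        (proj₂ subcritical ℓ (ℕ.m≤n*m ℓ 8))
        (*ᴿ-monoˡ-≤ {fromℕᴿ (2 * Subset.∣ E ∣) *ᴿ Y} {fromℕᴿ (2 * ℓ) *ᴿ Y} Z (^-nonNeg {fromℕᴿ 1 +ᴿ δ} ℓ 0≤1+δ)
          (*ᴿ-monoˡ-≤ {fromℕᴿ (2 * Subset.∣ E ∣)} {fromℕᴿ (2 * ℓ)} Y (^-nonNeg {fromℕᴿ (ℓ + 1)} (3 * r₀) (fromℕᴿ-nonNeg (ℓ + 1)))
            (fromℕᴿ-mono (ℕ.*-monoʳ-≤ 2 ∣E∣≤ℓ))))
        where
        Y = fromℕᴿ (ℓ + 1) ^ᴿ (3 * r₀)
        Z = (fromℕᴿ 1 +ᴿ δ) ^ᴿ ℓ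

    walksWithCode : List (Dart m) → ℕ
    walksWithCode = fibre good? firstTraversals (List.≡-dec _≟ᴰ_) (words (darts m) ℓ)

    -- If some good walk has the code `as`, every other one with this code runs inside its support,
    -- so `cnb` of that support counts them all. Otherwise the count is 0.
    walksWithCode≤ : ∀ as → fromℕᴿ (walksWithCode as) ≤ᴿ bound
    walksWithCode≤ as = [ none , some ]′ (filter-empty⊎witness hasCode? (words (darts m) ℓ))
      where
      HasCode : Vec (Dart m) ℓ → Set
      HasCode w = Good w × firstTraversals w ≡ as
      hasCode? : Decidable HasCode
      hasCode? w = good? w ×-dec List.≡-dec _≟ᴰ_ (firstTraversals w) as
      none : walksWithCode as ≡ 0 → fromℕᴿ (walksWithCode as) ≤ᴿ bound
      none eq = ≤ᴿ-trans {fromℕᴿ (walksWithCode as)} {fromℕᴿ 0} {bound}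
        (fromℕᴿ-mono {walksWithCode as} {0} (ℕ.≤-reflexive eq)) (0≤ᴿ {bound} bound≥0)
      some : ∃ HasCode → fromℕᴿ (walksWithCode as) ≤ᴿ bound
      some (w , (cl , z∈) , eq) =
        ≤ᴿ-trans {fromℕᴿ (walksWithCode as)} {fromℕᴿ (cnb G (walkGraph G cl) ℓ)} {bound}
          (fromℕᴿ-mono {walksWithCode as} {cnb G (walkGraph G cl) ℓ} ≤cnb) (cnb-walkGraph cl z∈)
        where
        open Subgraph (walkGraph G cl)
        inE : ∀ {x} → firstTraversals x ≡ as → ∀ {e} → e ∈ edges x → e Subset.∈ E
        inE {x} eq′ e∈ = ∈-subset⁺ ([ (λ ()) , id ]′
          (explore⁻ w (subst (λ bs → _ ∈ map edge bs) (trans eq′ (sym eq)) (explore⁺ x (inj₂ e∈)))))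
        ≤cnb : walksWithCode as ≤ cnb G (walkGraph G cl) ℓ
        ≤cnb = length-filter-mono hasCode?
          (λ x → closedNB? G x ×-dec VecAll.all? (λ a → edge a Subset.∈? E) x)
          (λ { ((cl′ , _) , eq′) → cl′ , toList⁻ (map⁻ (All.tabulate (inE eq′))) })
          (words (darts m) ℓ)

    -- The parities in `W` are pairwise distinct, so no walk is counted twice.
    sum-Nnb≤good : Unique W → sum (map (Nnb G ℓ) W) ≤ length (filter good? (words (darts m) ℓ))
    sum-Nnb≤good u = sum-fibres≤ (closedNB? G) walkParity _≟ⱽ_ u (words (darts m) ℓ)

    good≤codes : length (filter good? (words (darts m) ℓ)) ≤ sum (map walksWithCode (codesUpTo G ⌊ ℓ + Λ /2⌋ r₀))
    good≤codes = ℕ.≤-trans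
      (length-filter-mono good? (λ w → good? w ×-dec (firstTraversals w ∈ᶜ? codesUpTo G ⌊ ℓ + Λ /2⌋ r₀))
        (λ { g@(cl , z∈) → g , firstTraversals∈codes cl z∈ }) (words (darts m) ℓ))
      (≤sum-fibres good? firstTraversals (List.≡-dec _≟ᴰ_) (codesUpTo G ⌊ ℓ + Λ /2⌋ r₀) (words (darts m) ℓ))

    good-bound : fromℕᴿ (length (filter good? (words (darts m) ℓ))) ≤ᴿ
      fromℕᴿ (length (codesUpTo G ⌊ ℓ + Λ /2⌋ r₀)) *ᴿ bound
    good-bound = ≤ᴿ-trans {fromℕᴿ (length (filter good? (words (darts m) ℓ)))} {fromℕᴿ (sum (map walksWithCode cs))} {fromℕᴿ (length cs) *ᴿ bound}
      (fromℕᴿ-mono good≤codes) (sum-bound walksWithCode {bound} walksWithCode≤ cs)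
      where
      cs = codesUpTo G ⌊ ℓ + Λ /2⌋ r₀

-- The estimate in natural numbers

-- The factors come from `branching`, from `n * d` first darts and the 2 in `2 * ℓ`, from `jumps`,
-- and from `lengths`, in this order.
constant : ℕ → ℕ → ℕ → ℕ
constant r Λ d = (d ∸ 1) ^ Λ * (2 * d * (3 * d) ^ r * 2 ^ (3 * r))

module _ {ℓ M : ℕ} (n r Λ d : ℕ) (1≤ℓ : 1 ≤ ℓ) (M≤ℓ : M ≤ ℓ) (1≤a : 1 ≤ d ∸ 1) where

  private
    a = d ∸ 1
    k = M ∸ Λ

    instance
      a≢0 : NonZero a
      a≢0 = >-nonZero 1≤a
      ℓ≢0 : NonZero ℓ
      ℓ≢0 = >-nonZero 1≤ℓ

    -- The exponent on the left is `5 * r + 2`; the surplus up to `3 * (r + 1) ^ 2` is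
    -- `3 * (r * r) + r + 1`.
    powers : ℓ * ℓ * ((ℓ * ℓ) ^ r * ℓ ^ (3 * r)) ≤ ℓ ^ (3 * (r + 1) ^ 2)
    powers = begin
      ℓ * ℓ * ((ℓ * ℓ) ^ r * ℓ ^ (3 * r))        ≡⟨ cong (λ x → ℓ * ℓ * (x * ℓ ^ (3 * r))) (trans (^-distribʳ-* r ℓ ℓ) (sym (ℕ.^-distribˡ-+-* ℓ r r))) ⟩
      ℓ * ℓ * (ℓ ^ (r + r) * ℓ ^ (3 * r))        ≡⟨ cong (ℓ * ℓ *_) (ℕ.^-distribˡ-+-* ℓ (r + r) (3 * r)) ⟨
      ℓ * ℓ * ℓ ^ (r + r + 3 * r)                ≡⟨ ℕ.*-assoc ℓ ℓ _ ⟩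
      ℓ ^ (2 + (r + r + 3 * r))                  ≤⟨ ℕ.^-monoʳ-≤ ℓ exponent ⟩
      ℓ ^ (3 * (r + 1) ^ 2)                      ∎
      where
      open ℕ.≤-Reasoning
      exponent : 2 + (r + r + 3 * r) ≤ 3 * (r + 1) ^ 2
      exponent = ℕ.≤-trans (ℕ.m≤m+n _ (3 * (r * r) + r + 1)) (ℕ.≤-reflexive
        (solve 1 (λ r → con 2 :+ (r :+ r :+ con 3 :* r) :+ (con 3 :* (r :* r) :+ r :+ con 1) := con 3 :* ((r :+ con 1) :^ 2)) refl r))
        where open +-*-Solver

    jumps : (1 + M * (2 * M * d)) ^ r ≤ (3 * d) ^ r * (ℓ * ℓ) ^ r
    jumps = ℕ.≤-trans (ℕ.^-monoˡ-≤ r (begin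
      -- The summand 1 is absorbed by `d * (ℓ * ℓ)`, which accounts for the 3 in `3 * d`.
      1 + M * (2 * M * d)            ≤⟨ ℕ.+-mono-≤ (ℕ.*-mono-≤ (ℕ.≤-trans 1≤a (ℕ.m∸n≤m d 1)) (ℕ.*-mono-≤ 1≤ℓ 1≤ℓ)) (ℕ.*-mono-≤ M≤ℓ (ℕ.*-monoˡ-≤ d (ℕ.*-monoʳ-≤ 2 M≤ℓ))) ⟩
      d * (ℓ * ℓ) + ℓ * (2 * ℓ * d)  ≡⟨ solve 2 (λ d ℓ → d :* (ℓ :* ℓ) :+ ℓ :* (con 2 :* ℓ :* d) := con 3 :* d :* (ℓ :* ℓ)) refl d ℓ ⟩
      3 * d * (ℓ * ℓ)                ∎)) (ℕ.≤-reflexive (^-distribʳ-* r (3 * d) (ℓ * ℓ)))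
      where
      open ℕ.≤-Reasoning
      open +-*-Solver

    lengths : (ℓ + 1) ^ (3 * r) ≤ 2 ^ (3 * r) * ℓ ^ (3 * r)
    lengths = ℕ.≤-trans
      (ℕ.^-monoˡ-≤ (3 * r) (ℕ.+-monoʳ-≤ ℓ (ℕ.≤-trans 1≤ℓ (ℕ.m≤m+n ℓ 0))))
      (ℕ.≤-reflexive (^-distribʳ-* (3 * r) 2 ℓ))

    branching : a ^ M ≤ a ^ Λ * a ^ k
    branching = ℕ.≤-trans (ℕ.^-monoʳ-≤ a (ℕ.m≤n+m∸n M Λ)) (ℕ.≤-reflexive (ℕ.^-distribˡ-+-* a Λ k))

  codes*walks≤ : M * (n * d * a ^ M * (1 + M * (2 * M * d)) ^ r) * (2 * ℓ * (ℓ + 1) ^ (3 * r)) ≤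
    a ^ k * (constant r Λ d * n * ℓ ^ (3 * (r + 1) ^ 2))
  codes*walks≤ = begin
    M * (n * d * a ^ M * (1 + M * (2 * M * d)) ^ r) * (2 * ℓ * (ℓ + 1) ^ (3 * r))
      ≤⟨ ℕ.*-mono-≤ (ℕ.*-mono-≤ M≤ℓ (ℕ.*-mono-≤ (ℕ.*-monoʳ-≤ (n * d) branching) jumps)) (ℕ.*-monoʳ-≤ (2 * ℓ) lengths) ⟩
    ℓ * (n * d * (a ^ Λ * a ^ k) * ((3 * d) ^ r * (ℓ * ℓ) ^ r)) * (2 * ℓ * (2 ^ (3 * r) * ℓ ^ (3 * r)))
      ≡⟨ solve 9 (λ ℓ n d A B J L T U → ℓ :* (n :* d :* (A :* B) :* (J :* L)) :* (con 2 :* ℓ :* (T :* U))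
                 := B :* (A :* (con 2 :* d :* J :* T) :* n :* (ℓ :* ℓ :* (L :* U))))
           refl ℓ n d (a ^ Λ) (a ^ k) ((3 * d) ^ r) ((ℓ * ℓ) ^ r) (2 ^ (3 * r)) (ℓ ^ (3 * r)) ⟩
    a ^ k * (constant r Λ d * n * (ℓ * ℓ * ((ℓ * ℓ) ^ r * ℓ ^ (3 * r))))
      ≤⟨ ℕ.*-monoʳ-≤ (a ^ k) (ℕ.*-monoʳ-≤ (constant r Λ d * n) powers) ⟩
    a ^ k * (constant r Λ d * n * ℓ ^ (3 * (r + 1) ^ 2))  ∎
    where
    open ℕ.≤-Reasoning
    open +-*-Solver

-- Assembly in the reals

-- All factors except `D ^ᴿ ℓ` are natural numbers and are compared by a single inequality in `ℕ`.
-- Only then are `b`, `h` and `D` replaced by their real bounds `s ^ᴿ ℓ`, `H` and `D′`, and the two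
-- powers with exponent `ℓ` merged.
combine : ∀ {S N x y e b K n h ℓ} {D s H D′ : ℝ} →
  fromℕᴿ S ≤ᴿ fromℕᴿ N *ᴿ (fromℕᴿ x *ᴿ fromℕᴿ y ^ᴿ e *ᴿ D ^ᴿ ℓ) →
  N * (x * y ^ e) ≤ b * (K * n * h) →
  fromℕᴿ b ≤ᴿ s ^ᴿ ℓ → fromℕᴿ h ≤ᴿ H → D ≤ᴿ D′ →
  EventuallyNonNeg D → EventuallyNonNeg D′ → EventuallyNonNeg s → EventuallyNonNeg H →
  fromℕᴿ S ≤ᴿ fromℕᴿ K *ᴿ fromℕᴿ n *ᴿ H *ᴿ (D′ *ᴿ s) ^ᴿ ℓ
combine {S} {N} {x} {y} {e} {b} {K} {n} {h} {ℓ} {D} {s} {H} {D′} S≤ N≤ b≤ h≤ D≤ D≥0 D′≥0 s≥0 H≥0 =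
  ≤ᴿ-trans {fromℕᴿ S} {X₁} {X₆} S≤
  (≤ᴿ-trans {X₁} {X₂} {X₆} (pointwise-≡ {X₁} {X₂} λ i → trans
    (solve 4 (λ a b c d → a :* (b :* c :* d) := a :* (b :* c) :* d) refl (fromℕ N) (fromℕ x) (seq (fromℕᴿ y ^ᴿ e) i) (seq (D ^ᴿ ℓ) i))
    (cong (ℚ._* seq (D ^ᴿ ℓ) i) (trans (cong (λ q → fromℕ N ℚ.* (fromℕ x ℚ.* q)) (fromℕᴿ-^ y e i))
      (trans (cong (fromℕ N ℚ.*_) (sym (fromℕ-* x (y ^ e)))) (sym (fromℕ-* N (x * y ^ e)))))))
  (≤ᴿ-trans {X₂} {X₃} {X₆} (*ᴿ-monoˡ-≤ {fromℕᴿ (N * (x * y ^ e))} {fromℕᴿ (b * (K * n * h))} (D ^ᴿ ℓ) (^-nonNeg {D} ℓ D≥0) (fromℕᴿ-mono N≤))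
  (≤ᴿ-trans {X₃} {X₄} {X₆} (pointwise-≡ {X₃} {X₄} λ i → trans
    (cong (ℚ._* seq (D ^ᴿ ℓ) i) (trans (fromℕ-* b (K * n * h)) (cong (fromℕ b ℚ.*_) (trans (fromℕ-* (K * n) h) (cong (ℚ._* fromℕ h) (fromℕ-* K n))))))
    (solve 4 (λ b k h d → b :* (k :* h) :* d := k :* h :* (d :* b)) refl (fromℕ b) (fromℕ K ℚ.* fromℕ n) (fromℕ h) (seq (D ^ᴿ ℓ) i)))
  (≤ᴿ-trans {X₄} {X₅} {X₆} (*ᴿ-mono-≤ {fromℕᴿ K *ᴿ fromℕᴿ n *ᴿ fromℕᴿ h} {fromℕᴿ K *ᴿ fromℕᴿ n *ᴿ H} {D ^ᴿ ℓ *ᴿ fromℕᴿ b} {D′ ^ᴿ ℓ *ᴿ s ^ᴿ ℓ}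
      (*-nonNeg {D ^ᴿ ℓ} {fromℕᴿ b} (^-nonNeg {D} ℓ D≥0) (fromℕᴿ-nonNeg b))
      (*-nonNeg {fromℕᴿ K *ᴿ fromℕᴿ n} {H} Kn≥0 H≥0)
      (*ᴿ-mono-≤ {fromℕᴿ K *ᴿ fromℕᴿ n} {fromℕᴿ K *ᴿ fromℕᴿ n} {fromℕᴿ h} {H} (fromℕᴿ-nonNeg h) Kn≥0 (≤ᴿ-refl {fromℕᴿ K *ᴿ fromℕᴿ n}) h≤)
      (*ᴿ-mono-≤ {D ^ᴿ ℓ} {D′ ^ᴿ ℓ} {fromℕᴿ b} {s ^ᴿ ℓ} (fromℕᴿ-nonNeg b) (^-nonNeg {D′} ℓ D′≥0) (^ᴿ-monoˡ-≤ {D} {D′} ℓ D≥0 D′≥0 D≤) b≤))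
    (pointwise-≡ {X₅} {X₆} λ i → cong (fromℕ K ℚ.* fromℕ n ℚ.* seq H i ℚ.*_) (sym (^ᴿ-distrib-* D′ s ℓ i)))))))
  where
  open ℚ.+-*-Solver
  X₁ = fromℕᴿ N *ᴿ (fromℕᴿ x *ᴿ fromℕᴿ y ^ᴿ e *ᴿ D ^ᴿ ℓ)
  X₂ = fromℕᴿ (N * (x * y ^ e)) *ᴿ D ^ᴿ ℓ
  X₃ = fromℕᴿ (b * (K * n * h)) *ᴿ D ^ᴿ ℓ
  X₄ = fromℕᴿ K *ᴿ fromℕᴿ n *ᴿ fromℕᴿ h *ᴿ (D ^ᴿ ℓ *ᴿ fromℕᴿ b)
  X₅ = fromℕᴿ K *ᴿ fromℕᴿ n *ᴿ H *ᴿ (D′ ^ᴿ ℓ *ᴿ s ^ᴿ ℓ)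
  X₆ = fromℕᴿ K *ᴿ fromℕᴿ n *ᴿ H *ᴿ (D′ *ᴿ s) ^ᴿ ℓ
  Kn≥0 : EventuallyNonNeg (fromℕᴿ K *ᴿ fromℕᴿ n)
  Kn≥0 = *-nonNeg {fromℕᴿ K} {fromℕᴿ n} (fromℕᴿ-nonNeg K) (fromℕᴿ-nonNeg n)

-- With tolerance 1, `0 ≤ᴿ δ` says that the terms of `δ` plus 1 are eventually nonnegative.
1+δ-nonNeg : ∀ {δ} → fromℕᴿ 0 ≤ᴿ δ → EventuallyNonNeg (fromℕᴿ 1 +ᴿ δ)
1+δ-nonNeg {δ} 0≤δ with N , h ← 0≤δ (ℚ.positive⁻¹ 1ℚ) =
  N , λ {i} i≥ → subst (0ℚ ℚ.≤_) (ℚ.+-comm (seq δ i) 1ℚ) (h i≥)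

1≤1+δ : ∀ {δ} → fromℕᴿ 0 ≤ᴿ δ → fromℕᴿ 1 ≤ᴿ fromℕᴿ 1 +ᴿ δ
1≤1+δ {δ} 0≤δ = ≤ᴿ-trans {fromℕᴿ 1} {fromℕᴿ 1 +ᴿ fromℕᴿ 0} {fromℕᴿ 1 +ᴿ δ}
  (pointwise-≡ {fromℕᴿ 1} {fromℕᴿ 1 +ᴿ fromℕᴿ 0} (λ _ → refl))
  (+ᴿ-mono-≤ {fromℕᴿ 1} {fromℕᴿ 1} {fromℕᴿ 0} {δ} (≤ᴿ-refl {fromℕᴿ 1}) 0≤δ)

-- The factor `fromℕᴿ 1` is the absolute constant of the theorem.
fromℕᴿ-^≤ : ∀ ℓ p → fromℕᴿ (ℓ ^ p) ≤ᴿ (fromℕᴿ 1 *ᴿ fromℕᴿ ℓ) ^ᴿ p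
fromℕᴿ-^≤ ℓ p = pointwise-≡ {fromℕᴿ (ℓ ^ p)} {(fromℕᴿ 1 *ᴿ fromℕᴿ ℓ) ^ᴿ p} λ i → begin
  fromℕ (ℓ ^ p)                            ≡⟨ fromℕᴿ-^ ℓ p i ⟨
  seq (fromℕᴿ ℓ ^ᴿ p) i                    ≡⟨ ℚ.*-identityˡ _ ⟨
  1ℚ ℚ.* seq (fromℕᴿ ℓ ^ᴿ p) i             ≡⟨ cong (λ k → fromℕ k ℚ.* seq (fromℕᴿ ℓ ^ᴿ p) i) (ℕ.^-zeroˡ p) ⟨
  fromℕ (1 ^ p) ℚ.* seq (fromℕᴿ ℓ ^ᴿ p) i  ≡⟨ cong (ℚ._* seq (fromℕᴿ ℓ ^ᴿ p) i) (fromℕᴿ-^ 1 p i) ⟨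
  seq (fromℕᴿ 1 ^ᴿ p *ᴿ fromℕᴿ ℓ ^ᴿ p) i   ≡⟨ ^ᴿ-distrib-* (fromℕᴿ 1) (fromℕᴿ ℓ) p i ⟨
  seq ((fromℕᴿ 1 *ᴿ fromℕᴿ ℓ) ^ᴿ p) i      ∎
  where open ≡-Reasoning

module _ {n m : ℕ} (G : Graph n m) (r₀ Λ d ℓ : ℕ) (δ : ℝ) (W : List (𝔽₂^ m)) (0≤δ : fromℕᴿ 0 ≤ᴿ δ) (reg : Regular G d)
  (unique : Unique W) (weight : maxWeight W ≡ Λ) (Λ≤ℓ : Λ ≤ ℓ) (sub : Subcritical G r₀ δ ℓ) where

  private
    M = ⌊ ℓ + Λ /2⌋

    weight≤Λ : ∀ {z} → z ∈ W → ∣ z ∣ⱽ ≤ Λ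
    weight≤Λ z∈ = subst (_ ≤_) weight (All.lookup (xs≤max 0 (map ∣_∣ⱽ W)) (∈-map⁺ ∣_∣ⱽ z∈))

    2M≤ : 2 * M ≤ ℓ + Λ
    2M≤ = 2*⌊n/2⌋≤n (ℓ + Λ)

    M≤ℓ : M ≤ ℓ
    M≤ℓ = ℕ.*-cancelˡ-≤ 2 (ℕ.≤-trans 2M≤ (ℕ.+-monoʳ-≤ ℓ (ℕ.≤-trans Λ≤ℓ (ℕ.m≤m+n ℓ 0))))

    -- Each factor `d ∸ 1` costs two square roots, so `M ∸ Λ` of them fit under `√ (d ∸ 1) ^ᴿ ℓ`;
    -- `Λ` further ones are put into `constant`.
    2[M∸Λ]≤ℓ : 2 * (M ∸ Λ) ≤ ℓ
    2[M∸Λ]≤ℓ = begin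
      2 * (M ∸ Λ)       ≡⟨ ℕ.*-distribˡ-∸ 2 M Λ ⟩
      2 * M ∸ 2 * Λ     ≤⟨ ℕ.∸-mono 2M≤ (ℕ.m≤n*m Λ 2) ⟩
      ℓ + Λ ∸ Λ         ≡⟨ ℕ.m+n∸n≡m ℓ Λ ⟩
      ℓ                 ∎
      where open ℕ.≤-Reasoning

    open GoodWalks G r₀ ℓ Λ δ W (1+δ-nonNeg {δ} 0≤δ) Λ≤ℓ sub weight≤Λ

  sum-Nnb-bound : fromℕᴿ (sum (map (Nnb G ℓ) W)) ≤ᴿ
    fromℕᴿ (constant r₀ Λ d) *ᴿ fromℕᴿ n
    *ᴿ (fromℕᴿ 1 *ᴿ fromℕᴿ ℓ) ^ᴿ (3 * (r₀ + 1) ^ 2)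
    *ᴿ ((fromℕᴿ 1 +ᴿ δ) ^ᴿ (2 * (r₀ + 2)) *ᴿ √ (d ∸ 1)) ^ᴿ ℓ
  sum-Nnb-bound =
    let D   = fromℕᴿ 1 +ᴿ δ
        D′  = D ^ᴿ (2 * (r₀ + 2))
        H   = (fromℕᴿ 1 *ᴿ fromℕᴿ ℓ) ^ᴿ (3 * (r₀ + 1) ^ 2)
        Kn  = fromℕᴿ (constant r₀ Λ d) *ᴿ fromℕᴿ n
        X   = (D′ *ᴿ √ (d ∸ 1)) ^ᴿ ℓ
        S   = sum (map (Nnb G ℓ) W)
        g   = length (filter good? (words (darts m) ℓ))
        cs  = codesUpTo G M r₀
        D≥0  = 1+δ-nonNeg {δ} 0≤δ
        D′≥0 = ^-nonNeg {D} (2 * (r₀ + 2)) D≥0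
        H≥0  = ^-nonNeg {fromℕᴿ 1 *ᴿ fromℕᴿ ℓ} (3 * (r₀ + 1) ^ 2)
                 (*-nonNeg {fromℕᴿ 1} {fromℕᴿ ℓ} (fromℕᴿ-nonNeg 1) (fromℕᴿ-nonNeg ℓ))
        Kn≥0 = *-nonNeg {fromℕᴿ (constant r₀ Λ d)} {fromℕᴿ n} (fromℕᴿ-nonNeg (constant r₀ Λ d)) (fromℕᴿ-nonNeg n)
        X≥0  = ^-nonNeg {D′ *ᴿ √ (d ∸ 1)} ℓ (*-nonNeg {D′} {√ (d ∸ 1)} D′≥0 (√-nonNeg (d ∸ 1)))
        -- The exponent `2 * (r₀ + 2)` is at least 1 and `D` is at least 1, so a single factor `D`
        -- is dominated.
        D≤D′ = x≤x^ᴿ {D} {2 * (r₀ + 2)} (ℕ.≤-trans (ℕ.≤-trans (s≤s z≤n) (ℕ.m≤n+m 2 r₀)) (ℕ.m≤n*m (r₀ + 2) 2)) D≥0 (1≤1+δ {δ} 0≤δ)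
    in
    -- Without good walks the left side is 0 and the right side nonnegative; this covers `ℓ = 0` and
    -- `d` below 2. Otherwise a good walk gives `1 ≤ ℓ` and `1 ≤ d ∸ 1`, on which the estimates
    -- rest.
    [ (λ none → ≤ᴿ-trans {fromℕᴿ S} {fromℕᴿ 0} {Kn *ᴿ H *ᴿ X}
        (fromℕᴿ-mono {S} {0} (ℕ.≤-trans (sum-Nnb≤good unique) (ℕ.≤-reflexive none)))
        (0≤ᴿ {Kn *ᴿ H *ᴿ X} (*-nonNeg {Kn *ᴿ H} {X} (*-nonNeg {Kn} {H} Kn≥0 H≥0) X≥0)))
    , (λ (_ , cl , _) → let 1≤a = closed⇒1≤d∸1 G reg cl in
        combine {S} {length cs} {2 * ℓ} {ℓ + 1} {3 * r₀} {(d ∸ 1) ^ (M ∸ Λ)} {constant r₀ Λ d} {n} {ℓ ^ (3 * (r₀ + 1) ^ 2)} {ℓ} {D} {√ (d ∸ 1)} {H} {D′}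
          (≤ᴿ-trans {fromℕᴿ S} {fromℕᴿ g} {fromℕᴿ (length cs) *ᴿ (fromℕᴿ (2 * ℓ) *ᴿ fromℕᴿ (ℓ + 1) ^ᴿ (3 * r₀) *ᴿ D ^ᴿ ℓ)}
            (fromℕᴿ-mono {S} {g} (sum-Nnb≤good unique)) good-bound)
          (ℕ.≤-trans (ℕ.*-monoˡ-≤ (2 * ℓ * (ℓ + 1) ^ (3 * r₀)) (length-codesUpTo G reg 1≤a M r₀))
            (codes*walks≤ n r₀ Λ d (closed⇒1≤t G cl) M≤ℓ 1≤a))
          (a^k≤√^ (M ∸ Λ) ℓ 1≤a 2[M∸Λ]≤ℓ) (fromℕᴿ-^≤ ℓ (3 * (r₀ + 1) ^ 2)) D≤D′ D≥0 D′≥0 (√-nonNeg (d ∸ 1)) H≥0)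
    ]′ (filter-empty⊎witness good? (words (darts m) ℓ))

span-unique : ∀ {m} (vs : List (𝔽₂^ m)) → Unique (span vs)
span-unique vs = deduplicate-! _≟ⱽ_ (map (λ c → combination c (Vec.fromList vs)) (words (0ℙ ∷ 1ℙ ∷ []) (length vs)))

proposition22 : Σ[ C ∈ ℝ ] (∀ (r₀ : ℕ) (δ : ℝ) → fromℕᴿ 0 ≤ᴿ δ → ∀ (Λ d : ℕ) →
    Σ[ K ∈ ℝ ] (∀ {n m : ℕ} (G : Graph n m) → Connected G (whole G) → Regular G d →
    ∀ (𝒞 : List (Cycle G)) (L : ℕ) →
    All (EvenCycle G) 𝒞 → All (λ c → Cycle.len c ≤ L) 𝒞 → Consistent G 𝒞 →
    let W = span (map (χ G) 𝒞) in
    maxWeight W ≡ Λ →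
    ∀ (ℓ : ℕ) → Λ ≤ ℓ → Subcritical G r₀ δ ℓ →
    fromℕᴿ (sum (map (Nnb G ℓ) W)) ≤ᴿ
    K *ᴿ fromℕᴿ n
    *ᴿ (C *ᴿ fromℕᴿ ℓ) ^ᴿ (3 * (r₀ + 1) ^ 2)
    *ᴿ ((fromℕᴿ 1 +ᴿ δ) ^ᴿ (2 * (r₀ + 2)) *ᴿ √ (d ∸ 1)) ^ᴿ ℓ))
proposition22 = fromℕᴿ 1 , λ r₀ δ 0≤δ Λ d → fromℕᴿ (constant r₀ Λ d) ,
  λ G _ reg 𝒞 _ _ _ _ weight ℓ Λ≤ℓ sub →
    sum-Nnb-bound G r₀ Λ d ℓ δ (span (map (χ G) 𝒞)) 0≤δ reg (span-unique (map (χ G) 𝒞)) weight Λ≤ℓ sub
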